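{- Let $p\ge 1$ and $t$ be integers with $t \geq 2p+1$, and let $G=C_3^tC_5^p$. Then 1. $G$ is graceful when $p\equiv 0\pmod 4$ and $t\equiv 0,1\pmod 4$; 2. $G$ is graceful when $p\equiv 3\pmod 4$ and $t\equiv 0,3\pmod 4$; 3. $G$ is near graceful when $p\equiv 1\pmod 4$ and $t\equiv 0,3\pmod 4$; 4. $G$ is near graceful when $p\equiv 2\pmod 4$ and $t\equiv 0,1\pmod 4$.
   Context: $C_n^t$ denotes the union of $t$ cycles of length $n$ sharing exactly one common (central) vertex, and $C_3^tC_5^p$ denotes the graph obtained by identifying the central vertices of $C_3^t$ and $C_5^p$. For a graph $G$ with $m$ edges, a graceful labelling is an injective map $f:V(G)\to\{0,\ldots,m\}$ such that $g(uv)=|f(u)-f(v)|$ is a bijection $E(G)\to\{1,\ldots,m\}$. A near graceful labelling is an injective map $f:V(G)\to\{0,\ldots,m+1\}$ such that $g(uv)=|f(u)-f(v)|$ is a bijection onto $\{1,\ldots,m-1,m\}$ or onto $\{1,\ldots,m-1,m+1\}$. A graph is (near) graceful if it admits such a labelling. -}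

module Defs where

open import Data.Nat using (ℕ; zero; suc; _+_; _*_; _∸_; _≤_; _<_)
open import Data.Fin using (Fin; zero; suc)
open import Data.Product using (Σ; _×_; _,_; ∃)
open import Data.Sum using (_⊎_)
open import Relation.Binary.PropositionalEquality using (_≡_)
open import Function.Definitions using (Injective)

record Graph : Set₁ where
  field
    V   : Set
    E   : Set
    ends : E → V × V

open Graph public

∣_-_∣ : ℕ → ℕ → ℕ
∣ zero - n ∣ = n
∣ suc m - zero ∣ = suc m
∣ suc m - suc n ∣ = ∣ m - n ∣

edgeLabel : (G : Graph) → (V G → ℕ) → E G → ℕ
edgeLabel G f e with ends G e
... | (u , v) = ∣ f u - f v ∣

BijOnto : {A : Set} → (A → ℕ) → (ℕ → Set) → Set
BijOnto {A} g S =
  Injective _≡_ _≡_ g × (∀ a → S (g a)) × (∀ k → S k → ∃ λ a → g a ≡ k)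

-- m = number of edges
IsGraceful : (G : Graph) → (m : ℕ) → (V G → ℕ) → Set
IsGraceful G m f =
  Injective _≡_ _≡_ f × (∀ v → f v ≤ m)
  × BijOnto (edgeLabel G f) (λ k → 1 ≤ k × k ≤ m)

IsNearGraceful : (G : Graph) → (m : ℕ) → (V G → ℕ) → Set
IsNearGraceful G m f =
  Injective _≡_ _≡_ f × (∀ v → f v ≤ suc m)
  × (BijOnto (edgeLabel G f) (λ k → 1 ≤ k × k ≤ m)
     ⊎ BijOnto (edgeLabel G f) (λ k → (1 ≤ k × k < m) ⊎ k ≡ suc m))

-- The graph C_3^t C_5^p: t triangles and p pentagons sharing one central vertex.
data CV (t p : ℕ) : Set where
  center : CV t p
  tri    : Fin t → Fin 2 → CV t p
  pent   : Fin p → Fin 4 → CV t p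

data CE (t p : ℕ) : Set where
  triE  : Fin t → Fin 3 → CE t p
  pentE : Fin p → Fin 5 → CE t p

CEnds : (t p : ℕ) → CE t p → CV t p × CV t p
CEnds t p (triE i zero)                   = center , tri i zero
CEnds t p (triE i (suc zero))             = tri i zero , tri i (suc zero)
CEnds t p (triE i (suc (suc _)))          = tri i (suc zero) , center
CEnds t p (pentE j zero)                  = center , pent j zero
CEnds t p (pentE j (suc zero))            = pent j zero , pent j (suc zero)
CEnds t p (pentE j (suc (suc zero)))      = pent j (suc zero) , pent j (suc (suc zero))
CEnds t p (pentE j (suc (suc (suc zero)))) = pent j (suc (suc zero)) , pent j (suc (suc (suc zero)))
CEnds t p (pentE j (suc (suc (suc (suc _))))) = pent j (suc (suc (suc zero))) , center

C3C5 : ℕ → ℕ → Graph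
C3C5 t p = record { V = CV t p ; E = CE t p ; ends = CEnds t p }

edges : ℕ → ℕ → ℕ
edges t p = 3 * t + 5 * p

Graceful : ℕ → ℕ → Set
Graceful t p = ∃ λ f → IsGraceful (C3C5 t p) (edges t p) f

NearGraceful : ℕ → ℕ → Set
NearGraceful t p = ∃ λ f → IsNearGraceful (C3C5 t p) (edges t p) f

{-# OPTIONS --safe #-}
-- Put 0 at the centre and write q = p - 1, n = t + 1. Three nested families of pairs form an
-- extended Langford system: n pairs with differences q+1, ..., q+n whose end points are the
-- numbers 1, ..., 2n+1 with a single y left out. Shifted by N = q + n, a pair {x, x+δ} becomes a
-- triangle with edge labels δ, N+x, N+x+δ.
-- There is one triangle too many and the label Y = N+y is missing. Let T = L+τ be a label above
-- L = N+2n+1 with T - Y = 2v even. The midpoint R = Y+v belongs to exactly one triangle {R, R'};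
-- replacing this triangle by the pentagon 0, T, v, R, R' uses its labels together with Y and T.
-- The other q pentagons have the form 0, L+u+b, b, L+w+b, L+d, with edge labels L+u+b, L+u, L+w,
-- |w+b-d|, L+d. They consume 1, ..., q as the |w+b-d| and all labels above L except T. Such a
-- system consists of two families in which everything varies linearly and at most one further
-- pentagon; τ is its hole, and the parities of τ, q and t make T - Y even.
module Submission where

open import Defs
open import Data.Nat using (ℕ; zero; suc; _+_; _*_; _≤_; _<_; _≡ᵇ_; z≤n; s≤s; s≤s⁻¹; _%_; _/_)
open import Data.Nat.Properties
open import Data.Nat.DivMod using (m≡m%n+[m/n]*n; [m+kn]%n≡m%n; _divMod_; result)
open import Data.Nat.Tactic.RingSolver using (solve-∀)
open import Data.Bool using (Bool; true; false; _∧_; T)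
open import Data.Fin using (Fin; zero; suc)
open import Data.Maybe using (Maybe; just; nothing)
open import Data.Product using (∃; ∃₂; _×_; _,_; proj₁; proj₂)
open import Data.Sum using (_⊎_; inj₁; inj₂)
open import Data.List using (List; []; _∷_; _++_; map; concatMap; length; lookup; allFin)
open import Data.List.Properties using (map-++; ++-assoc; ++-identityʳ; length-map; map-concatMap; concatMap-map; concatMap-cong; concatMap-++; map-tabulate; tabulate-lookup)
open import Data.List.Membership.Propositional using (_∈_; find)
open import Data.List.Membership.Propositional.Properties using (∈-map⁺; ∈-map⁻; ∈-++⁺ˡ; ∈-++⁺ʳ; ∈-++⁻; ∈-∃++; ∈-concatMap⁺; ∈-concatMap⁻; ∈-allFin)
open import Data.List.Relation.Unary.Any using (here; there)
import Data.List.Relation.Unary.Any as Any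
open import Data.List.Relation.Unary.All using (All; []; _∷_)
import Data.List.Relation.Unary.All as All
import Data.List.Relation.Unary.All.Properties as All
open import Data.List.Relation.Unary.AllPairs using ([]; _∷_)
open import Data.List.Relation.Unary.Unique.Propositional using (Unique)
import Data.List.Relation.Unary.Unique.Propositional.Properties as Unique
open import Data.List.Relation.Binary.Permutation.Propositional using (_↭_; ↭-refl; ↭-sym; ↭-trans; ↭-reflexive; ↭⇒↭ₛ; prep; swap; module PermutationReasoning)
open import Data.List.Relation.Binary.Permutation.Propositional.Properties using (++⁺; ++⁺ˡ; ++⁺ʳ; shift; shifts; ++-comm; drop-∷; map⁺; ↭-length; ∈-resp-↭; All-resp-↭; ++-commutativeMonoid)
import Data.List.Relation.Binary.Permutation.Setoid.Properties as Permutationₛ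
import Algebra.Solver.CommutativeMonoid as CommutativeMonoidSolver
open import Function using (_∘_)
open import Function.Definitions using (Injective)
open import Relation.Binary.PropositionalEquality using (_≡_; _≢_; refl; sym; trans; cong; cong₂; subst; subst₂; setoid; module ≡-Reasoning)
open import Relation.Nullary using (contradiction)

-- Injectivity and bijectivity read off from lists of values

Unique-resp-↭ : {A : Set} {xs ys : List A} → xs ↭ ys → Unique xs → Unique ys
Unique-resp-↭ {A} = Permutationₛ.Unique-resp-↭ (setoid A) ∘ ↭⇒↭ₛ

-- Elements at different positions of `xs` have different values, so equal values force equal
-- positions.
unique-map⇒injective : {A : Set} (f : A → ℕ) {xs : List A} → Unique (map f xs) → (∀ a → a ∈ xs) → Injective _≡_ _≡_ f
unique-map⇒injective f {xs} u all {x} {y} = go xs u (all x) (all y)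
  where
  go : ∀ xs → Unique (map f xs) → x ∈ xs → y ∈ xs → f x ≡ f y → x ≡ y
  go (z ∷ xs) u        (here refl) (here refl) eq = refl
  go (z ∷ xs) (z∉ ∷ u) (here refl) (there y∈)  eq = contradiction eq (All.lookup z∉ (∈-map⁺ f y∈))
  go (z ∷ xs) (z∉ ∷ u) (there x∈)  (here refl) eq = contradiction (sym eq) (All.lookup z∉ (∈-map⁺ f x∈))
  go (z ∷ xs) (_ ∷ u)  (there x∈)  (there y∈)  eq = go xs u x∈ y∈ eq

bijOnto : {A : Set} (g : A → ℕ) {xs : List A} (S : ℕ → Set) {ks : List ℕ} → (∀ a → a ∈ xs) → map g xs ↭ ks →
          Unique ks → (∀ {k} → k ∈ ks → S k) → (∀ {k} → S k → k ∈ ks) → BijOnto g S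
bijOnto g S all σ u sound complete =
  unique-map⇒injective g (Unique-resp-↭ (↭-sym σ) u) all ,
  (λ a → sound (∈-resp-↭ σ (∈-map⁺ g (all a)))) ,
  λ k Sk → let (a , _ , eq) = ∈-map⁻ g (∈-resp-↭ (↭-sym σ) (complete Sk)) in a , sym eq

-- Labellings with centre 0 as lists of triangles and pentagons

Triangle Pentagon : Set
Triangle = ℕ × ℕ
Pentagon = ℕ × ℕ × ℕ × ℕ

-- The distances to the centre keep the form with 0, so that they agree with `edgeLabel` by
-- computation.
triVertices triEdges : Triangle → List ℕ
triVertices (a , b) = a ∷ b ∷ []
triEdges (a , b) = ∣ 0 - a ∣ ∷ ∣ a - b ∣ ∷ ∣ b - 0 ∣ ∷ []

pentVertices pentEdges : Pentagon → List ℕ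
pentVertices (a , b , c , d) = a ∷ b ∷ c ∷ d ∷ []
pentEdges (a , b , c , d) = ∣ 0 - a ∣ ∷ ∣ a - b ∣ ∷ ∣ b - c ∣ ∷ ∣ c - d ∣ ∷ ∣ d - 0 ∣ ∷ []

vertexLabels edgeLabels : List Triangle → List Pentagon → List ℕ
vertexLabels ts ps = 0 ∷ concatMap triVertices ts ++ concatMap pentVertices ps
edgeLabels ts ps = concatMap triEdges ts ++ concatMap pentEdges ps

-- The numbers of cycles are the lengths of the lists, so that `lookup` gives the labels. The
-- prescribed `t` and `p` enter at the end by transport along the length equations.
module Labelling (ts : List Triangle) (ps : List Pentagon) where

  private
    t = length ts
    p = length ps

  label : CV t p → ℕ
  label center                           = 0
  label (tri i zero)                     = proj₁ (lookup ts i)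
  label (tri i (suc _))                  = proj₂ (lookup ts i)
  label (pent j zero)                    = proj₁ (lookup ps j)
  label (pent j (suc zero))              = proj₁ (proj₂ (lookup ps j))
  label (pent j (suc (suc zero)))        = proj₁ (proj₂ (proj₂ (lookup ps j)))
  label (pent j (suc (suc (suc _))))     = proj₂ (proj₂ (proj₂ (lookup ps j)))

  private
    triV : Fin t → List (CV t p)
    triV i = tri i zero ∷ tri i (suc zero) ∷ []

    pentV : Fin p → List (CV t p)
    pentV j = pent j zero ∷ pent j (suc zero) ∷ pent j (suc (suc zero)) ∷ pent j (suc (suc (suc zero))) ∷ []

    triEs : Fin t → List (CE t p)
    triEs i = triE i zero ∷ triE i (suc zero) ∷ triE i (suc (suc zero)) ∷ []

    pentEs : Fin p → List (CE t p)
    pentEs j = pentE j zero ∷ pentE j (suc zero) ∷ pentE j (suc (suc zero)) ∷ pentE j (suc (suc (suc zero))) ∷ pentE j (suc (suc (suc (suc zero)))) ∷ []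

  vertices : List (CV t p)
  vertices = center ∷ concatMap triV (allFin t) ++ concatMap pentV (allFin p)

  edgeList : List (CE t p)
  edgeList = concatMap triEs (allFin t) ++ concatMap pentEs (allFin p)

  private
    in-block : {n : ℕ} {X : Set} (h : Fin n → List X) (i : Fin n) {x : X} → x ∈ h i → x ∈ concatMap h (allFin n)
    in-block h i x∈ = ∈-concatMap⁺ h (Any.map (λ { refl → x∈ }) (∈-allFin i))

    in-pentV : ∀ j k → pent j k ∈ pentV j
    in-pentV j zero = here refl
    in-pentV j (suc zero) = there (here refl)
    in-pentV j (suc (suc zero)) = there (there (here refl))
    in-pentV j (suc (suc (suc zero))) = there (there (there (here refl)))

    in-triV : ∀ i k → tri i k ∈ triV i
    in-triV i zero = here refl
    in-triV i (suc zero) = there (here refl)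

    in-triEs : ∀ i k → triE i k ∈ triEs i
    in-triEs i zero = here refl
    in-triEs i (suc zero) = there (here refl)
    in-triEs i (suc (suc zero)) = there (there (here refl))

    in-pentEs : ∀ j k → pentE j k ∈ pentEs j
    in-pentEs j zero = here refl
    in-pentEs j (suc zero) = there (here refl)
    in-pentEs j (suc (suc zero)) = there (there (here refl))
    in-pentEs j (suc (suc (suc zero))) = there (there (there (here refl)))
    in-pentEs j (suc (suc (suc (suc zero)))) = there (there (there (there (here refl))))

    map-blocks : {A X : Set} (f : X → ℕ) (xs : List A) (h : Fin (length xs) → List X) (labels : A → List ℕ) →
                 (∀ i → map f (h i) ≡ labels (lookup xs i)) → map f (concatMap h (allFin (length xs))) ≡ concatMap labels xs
    map-blocks f xs h labels eq = begin
      map f (concatMap h (allFin _))                   ≡⟨ map-concatMap f h (allFin _) ⟩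
      concatMap (map f ∘ h) (allFin _)                 ≡⟨ concatMap-cong eq (allFin _) ⟩
      concatMap (labels ∘ lookup xs) (allFin _)        ≡⟨ concatMap-map labels (lookup xs) (allFin _) ⟨
      concatMap labels (map (lookup xs) (allFin _))    ≡⟨ cong (concatMap labels) (trans (map-tabulate (λ i → i) (lookup xs)) (tabulate-lookup xs)) ⟩
      concatMap labels xs                              ∎
      where open ≡-Reasoning

  ∈-vertices : ∀ x → x ∈ vertices
  ∈-vertices center     = here refl
  ∈-vertices (tri i k)  = there (∈-++⁺ˡ (in-block triV i (in-triV i k)))
  ∈-vertices (pent j k) = there (∈-++⁺ʳ (concatMap triV (allFin t)) (in-block pentV j (in-pentV j k)))

  ∈-edgeList : ∀ e → e ∈ edgeList
  ∈-edgeList (triE i k)  = ∈-++⁺ˡ (in-block triEs i (in-triEs i k))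
  ∈-edgeList (pentE j k) = ∈-++⁺ʳ (concatMap triEs (allFin t)) (in-block pentEs j (in-pentEs j k))

  map-label : map label vertices ≡ vertexLabels ts ps
  map-label = cong (0 ∷_) (trans (map-++ label (concatMap triV (allFin t)) _)
    (cong₂ _++_ (map-blocks label ts triV triVertices (λ i → refl)) (map-blocks label ps pentV pentVertices (λ j → refl))))

  map-edgeLabel : map (edgeLabel (C3C5 t p) label) edgeList ≡ edgeLabels ts ps
  map-edgeLabel = trans (map-++ _ (concatMap triEs (allFin t)) _)
    (cong₂ _++_ (map-blocks _ ts triEs triEdges (λ i → refl)) (map-blocks _ ps pentEs pentEdges (λ j → refl)))

  label-injective : Unique (vertexLabels ts ps) → Injective _≡_ _≡_ label
  label-injective u = unique-map⇒injective label (subst Unique (sym map-label) u) ∈-vertices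

  label-bounded : ∀ {m} → All (_≤ m) (vertexLabels ts ps) → ∀ x → label x ≤ m
  label-bounded {m} b x = All.lookup b (subst (label x ∈_) map-label (∈-map⁺ label (∈-vertices x)))

  edgeLabel-bijOnto : (S : ℕ → Set) {ks : List ℕ} → edgeLabels ts ps ↭ ks →
                      Unique ks → (∀ {k} → k ∈ ks → S k) → (∀ {k} → S k → k ∈ ks) → BijOnto (edgeLabel (C3C5 t p) label) S
  edgeLabel-bijOnto S σ = bijOnto _ S ∈-edgeList (subst (_↭ _) (sym map-edgeLabel) σ)

-- Arithmetic progressions

prog : ℕ → ℕ → ℕ → List ℕ
prog d a zero    = []
-- With `d + a`, not `a + d`, the next term computes to `suc a` for `d = 1` and to `2 + a` for
-- `d = 2`.
prog d a (suc n) = a ∷ prog d (d + a) n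

interval : ℕ → ℕ → List ℕ
interval = prog 1

length-prog : ∀ d a n → length (prog d a n) ≡ n
length-prog d a zero    = refl
length-prog d a (suc n) = cong suc (length-prog d (d + a) n)

prog-++ : ∀ d a m n → prog d a m ++ prog d (a + m * d) n ≡ prog d a (m + n)
prog-++ d a zero    n = cong (λ x → prog d x n) (+-identityʳ a)
prog-++ d a (suc m) n = cong (a ∷_) (trans (cong (λ x → prog d (d + a) m ++ prog d x n) (lemma a d (m * d))) (prog-++ d (d + a) m n))
  where
  lemma : ∀ a d x → a + (d + x) ≡ (d + a) + x
  lemma = solve-∀

interval-++ : ∀ a m n → interval a m ++ interval (a + m) n ≡ interval a (m + n)
interval-++ a m n = trans (cong (λ x → interval a m ++ interval (a + x) n) (lemma m)) (prog-++ 1 a m n)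
  where
  lemma : ∀ m → m ≡ m * 1
  lemma = solve-∀

prog-snoc : ∀ d a n → (a + n * d) ∷ prog d a n ↭ prog d a (suc n)
prog-snoc d a n = begin
  (a + n * d) ∷ prog d a n             ↭⟨ ++-comm (_ ∷ []) (prog d a n) ⟩
  prog d a n ++ prog d (a + n * d) 1   ≡⟨ prog-++ d a n 1 ⟩
  prog d a (n + 1)                     ≡⟨ cong (prog d a) (+-comm n 1) ⟩
  prog d a (suc n)                     ∎
  where open PermutationReasoning

interval-snoc : ∀ a n → (a + n) ∷ interval a n ↭ interval a (suc n)
interval-snoc a n = subst (λ x → (a + x) ∷ interval a n ↭ interval a (suc n)) (lemma n) (prog-snoc 1 a n)
  where
  lemma : ∀ m → m * 1 ≡ m
  lemma = solve-∀

-- Differences, gaps and inner labels arise in steps of two; this joins the two parity classes.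
interleave : ∀ a n → prog 2 a n ++ prog 2 (suc a) n ↭ interval a (n + n)
interleave a zero    = ↭-refl
interleave a (suc n) = begin
  a ∷ prog 2 (2 + a) n ++ suc a ∷ prog 2 (3 + a) n    ↭⟨ prep a (shift (suc a) (prog 2 (2 + a) n) _) ⟩
  a ∷ suc a ∷ prog 2 (2 + a) n ++ prog 2 (3 + a) n    ↭⟨ prep a (prep (suc a) (interleave (2 + a) n)) ⟩
  a ∷ suc a ∷ interval (2 + a) (n + n)                ≡⟨ cong (λ m → a ∷ interval (suc a) m) (+-suc n n) ⟨
  interval a (suc n + suc n)                          ∎
  where open PermutationReasoning

interleave-odd : ∀ a n → prog 2 a (suc n) ++ prog 2 (suc a) n ↭ interval a (suc (n + n))
interleave-odd a n = prep a (↭-trans (++-comm (prog 2 (2 + a) n) (prog 2 (suc a) n)) (interleave (suc a) n))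

map-+-interval : ∀ c a n → map (c +_) (interval a n) ≡ interval (c + a) n
map-+-interval c a zero    = refl
map-+-interval c a (suc n) = cong (c + a ∷_) (trans (map-+-interval c (suc a) n) (cong (λ x → interval x n) (+-suc c a)))

interval-≥ : ∀ a n → All (a ≤_) (interval a n)
interval-≥ a zero    = []
interval-≥ a (suc n) = ≤-refl ∷ All.map (≤-trans (n≤1+n a)) (interval-≥ (suc a) n)

interval-< : ∀ a n → All (_< a + n) (interval a n)
interval-< a zero    = []
interval-< a (suc n) = ≤-trans (s≤s (m≤m+n a n)) (≤-reflexive (sym (+-suc a n))) ∷ subst (λ x → All (_< x) (interval (suc a) n)) (sym (+-suc a n)) (interval-< (suc a) n)

interval-unique : ∀ a n → Unique (interval a n)
interval-unique a zero    = []
interval-unique a (suc n) = All.map <⇒≢ (interval-≥ (suc a) n) ∷ interval-unique (suc a) n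

∈-interval : ∀ a n {k} → a ≤ k → k < a + n → k ∈ interval a n
∈-interval a zero    {k} a≤k k<a = contradiction (<-≤-trans k<a (≤-trans (≤-reflexive (+-identityʳ a)) a≤k)) (<-irrefl refl)
∈-interval a (suc n) {k} a≤k k<a with m≤n⇒m<n∨m≡n a≤k
... | inj₂ refl = here refl
... | inj₁ a<k  = there (∈-interval (suc a) n a<k (subst (k <_) (+-suc a n) k<a))

unique-suffix : {A : Set} (xs : List A) {ys : List A} → Unique (xs ++ ys) → Unique ys
unique-suffix []       u       = u
unique-suffix (x ∷ xs) (_ ∷ u) = unique-suffix xs u

unique-++-< : ∀ {N xs ys} → Unique xs → Unique ys → All (_≤ N) xs → All (N <_) ys → Unique (xs ++ ys)
unique-++-< ux uy xs≤ ys> = Unique.++⁺ ux uy λ { (x∈xs , x∈ys) → <-irrefl refl (<-≤-trans (All.lookup ys> x∈ys) (All.lookup xs≤ x∈xs)) }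

interval-shift : ∀ L K → interval 1 L ++ map (L +_) (interval 1 K) ≡ interval 1 (L + K)
interval-shift L K = trans (cong (interval 1 L ++_) (trans (map-+-interval L 1 K) (cong (λ z → interval z K) (+-comm L 1)))) (interval-++ 1 L K)

-- Hooked intervals, the edge labels of the near graceful case

hooked : ℕ → List ℕ
hooked N = interval 1 N ++ (2 + N) ∷ []

-- Tilings produce intervals only. The hole is therefore first filled by an extra element, which is
-- cancelled here.
unhook : ∀ N {xs} → suc N ∷ xs ↭ interval 1 (2 + N) → xs ↭ hooked N
unhook N {xs} σ = drop-∷ (begin
  suc N ∷ xs                           ↭⟨ σ ⟩
  interval 1 (2 + N)                   ≡⟨ cong (interval 1) (+-comm 2 N) ⟩
  interval 1 (N + 2)                   ≡⟨ interval-++ 1 N 2 ⟨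
  interval 1 N ++ interval (suc N) 2   ↭⟨ shift (suc N) (interval 1 N) _ ⟩
  suc N ∷ hooked N                     ∎)
  where open PermutationReasoning

hooked-unique : ∀ N → Unique (hooked N)
hooked-unique N = unique-++-< {N = N} (interval-unique 1 N) ([] ∷ []) (All.map s≤s⁻¹ (interval-< 1 N)) (n≤1+n (suc N) ∷ [])

hooked-sound : ∀ N {k} → k ∈ hooked N → (1 ≤ k × k < suc N) ⊎ k ≡ suc (suc N)
hooked-sound N k∈ with ∈-++⁻ (interval 1 N) k∈
... | inj₁ k∈′       = inj₁ (All.lookup (interval-≥ 1 N) k∈′ , All.lookup (interval-< 1 N) k∈′)
... | inj₂ (here eq) = inj₂ eq

hooked-complete : ∀ N {k} → (1 ≤ k × k < suc N) ⊎ k ≡ suc (suc N) → k ∈ hooked N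
hooked-complete N (inj₁ (1≤k , k<)) = ∈-++⁺ˡ (∈-interval 1 N 1≤k k<)
hooked-complete N (inj₂ eq)         = ∈-++⁺ʳ (interval 1 N) (here eq)

hooked-shift : ∀ L K → interval 1 L ++ map (L +_) (hooked K) ≡ hooked (L + K)
hooked-shift L K = begin
  interval 1 L ++ map (L +_) (hooked K)                                ≡⟨ cong (interval 1 L ++_) (map-++ (L +_) (interval 1 K) _) ⟩
  interval 1 L ++ map (L +_) (interval 1 K) ++ (L + (2 + K)) ∷ []      ≡⟨ ++-assoc (interval 1 L) _ _ ⟨
  (interval 1 L ++ map (L +_) (interval 1 K)) ++ (L + (2 + K)) ∷ []    ≡⟨ cong₂ (λ xs z → xs ++ z ∷ []) (interval-shift L K) (two L K) ⟩
  hooked (L + K)                                                       ∎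
  where
  open ≡-Reasoning
  two : ∀ L K → L + (2 + K) ≡ 2 + (L + K)
  two = solve-∀

-- Tables of labels read by rows or by columns

concatMap-transpose : {A : Set} (fs : List (A → ℕ)) (xs : List A) →
                      concatMap (λ x → map (λ f → f x) fs) xs ↭ concatMap (λ f → map f xs) fs
concatMap-transpose []       []       = ↭-refl
concatMap-transpose []       (x ∷ xs) = concatMap-transpose [] xs
concatMap-transpose {A} (f ∷ fs) xs = ↭-trans (column xs) (++⁺ˡ (map f xs) (concatMap-transpose fs xs))
  where
  row : A → List ℕ
  row x = map (λ f → f x) fs
  column : ∀ xs → concatMap (λ x → f x ∷ row x) xs ↭ map f xs ++ concatMap row xs
  column []       = ↭-refl
  column (x ∷ xs) = prep (f x) (↭-trans (++⁺ˡ (row x) (column xs)) (shifts (row x) (map f xs)))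

-- Each cycle contributes one small label and several labels shifted by `c`; the small ones are
-- collected in front and the common shift is pulled out.
concatMap-extract : {A : Set} (c : ℕ) {row : A → List ℕ} {g : A → ℕ} {h : A → List ℕ} →
                    (∀ x → row x ↭ g x ∷ map (c +_) (h x)) →
                    ∀ xs → concatMap row xs ↭ map g xs ++ map (c +_) (concatMap h xs)
concatMap-extract c σ [] = ↭-refl
concatMap-extract c {row} {g} {h} σ (x ∷ xs) = begin
  row x ++ concatMap row xs                                               ↭⟨ ++⁺ (σ x) (concatMap-extract c σ xs) ⟩
  g x ∷ map (c +_) (h x) ++ map g xs ++ map (c +_) (concatMap h xs)       ↭⟨ prep (g x) (shifts (map (c +_) (h x)) (map g xs)) ⟩
  g x ∷ map g xs ++ map (c +_) (h x) ++ map (c +_) (concatMap h xs)       ≡⟨ cong (λ z → g x ∷ map g xs ++ z) (map-++ (c +_) (h x) (concatMap h xs)) ⟨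
  g x ∷ map g xs ++ map (c +_) (h x ++ concatMap h xs)                    ∎
  where open PermutationReasoning

-- Tilings by intervals with linear endpoints

-- lin a b c stands for a + b x + c y.
record Lin : Set where
  constructor lin
  field
    const coeff₁ coeff₂ : ℕ

one : Lin
one = lin 1 0 0

_⊕_ : Lin → Lin → Lin
lin a b c ⊕ lin a′ b′ c′ = lin (a + a′) (b + b′) (c + c′)

infixl 6 _⊕_

_==_ : Lin → Lin → Bool
lin a b c == lin a′ b′ c′ = (a ≡ᵇ a′) ∧ ((b ≡ᵇ b′) ∧ (c ≡ᵇ c′))

==⇒≡ : ∀ l m → T (l == m) → l ≡ m
==⇒≡ (lin a b c) (lin a′ b′ c′) h with a ≡ᵇ a′ | ≡ᵇ⇒≡ a a′
... | true | f with b ≡ᵇ b′ | ≡ᵇ⇒≡ b b′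
...   | true | g with f _ | g _ | ≡ᵇ⇒≡ c c′ h
...     | refl | refl | refl = refl

-- An interval, given by its first element and its length.
Segment : Set
Segment = Lin × Lin

pick : Lin → List Segment → Maybe (Lin × List Segment)
pick s []              = nothing
pick s ((x , l) ∷ segs) with s == x
... | true  = just (l , segs)
... | false with pick s segs
...   | just (l′ , rest) = just (l′ , (x , l) ∷ rest)
...   | nothing          = nothing

-- Joins the segments, in whatever order fits, into one interval starting at s and returns its
-- end. The first argument is fuel.
tile : ℕ → Lin → List Segment → Maybe Lin
tile zero    s segs = nothing
tile (suc n) s []   = just s
tile (suc n) s segs@(_ ∷ _) with pick s segs
... | just (l , rest) = tile n (s ⊕ l) rest
... | nothing         = nothing

module Evaluation (x y : ℕ) where

  -- The second variable comes first, so that `lin a b 0` evaluates to `a + b * x` by computation.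
  -- The tables in one variable then match explicit expressions without rewriting.
  ⟦_⟧ : Lin → ℕ
  ⟦ lin a b c ⟧ = a + (c * y + b * x)

  ⟦⟧-⊕ : ∀ l m → ⟦ l ⊕ m ⟧ ≡ ⟦ l ⟧ + ⟦ m ⟧
  ⟦⟧-⊕ (lin a b c) (lin a′ b′ c′) = lemma a a′ b b′ c c′ x y
    where
    lemma : ∀ a a′ b b′ c c′ x y → a + a′ + ((c + c′) * y + (b + b′) * x) ≡ a + (c * y + b * x) + (a′ + (c′ * y + b′ * x))
    lemma = solve-∀

  segment : Segment → List ℕ
  segment (s , l) = interval ⟦ s ⟧ ⟦ l ⟧

  segments : List Segment → List ℕ
  segments = concatMap segment

  pick-sound : ∀ s segs {l rest} → pick s segs ≡ just (l , rest) → segments segs ↭ segment (s , l) ++ segments rest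
  pick-sound s ((x , l) ∷ segs) eq with s == x | ==⇒≡ s x
  pick-sound s ((x , l) ∷ segs) refl | true  | f with refl ← f _ = ↭-refl
  pick-sound s ((x , l) ∷ segs) eq   | false | _ with pick s segs | pick-sound s segs
  pick-sound s ((x , l) ∷ segs) refl | false | _ | just (l′ , rest) | ih =
    ↭-trans (++⁺ˡ (segment (x , l)) (ih refl)) (shifts (segment (x , l)) (segment (s , l′)))

  -- `Lin` has no subtraction, so the length `k` of the union is known only through its end point.
  tile-sound : ∀ n s {e} segs → tile n s segs ≡ just e → ∃ λ k → segments segs ↭ interval ⟦ s ⟧ k × ⟦ s ⟧ + k ≡ ⟦ e ⟧
  tile-sound (suc n) s []          refl = 0 , ↭-refl , +-identityʳ _
  tile-sound (suc n) s segs@(_ ∷ _) eq with pick s segs | pick-sound s segs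
  ... | just (l , rest) | σ with tile-sound n (s ⊕ l) rest eq
  ...   | k , ρ , end = ⟦ l ⟧ + k , τ , trans (sym (+-assoc ⟦ s ⟧ ⟦ l ⟧ k)) (trans (cong (_+ k) (sym (⟦⟧-⊕ s l))) end)
    where
    open PermutationReasoning
    τ = begin
      segments segs                                        ↭⟨ σ refl ⟩
      segment (s , l) ++ segments rest                     ↭⟨ ++⁺ˡ (segment (s , l)) ρ ⟩
      segment (s , l) ++ interval ⟦ s ⊕ l ⟧ k              ≡⟨ cong (λ z → segment (s , l) ++ interval z k) (⟦⟧-⊕ s l) ⟩
      segment (s , l) ++ interval (⟦ s ⟧ + ⟦ l ⟧) k        ≡⟨ interval-++ ⟦ s ⟧ ⟦ l ⟧ k ⟩
      interval ⟦ s ⟧ (⟦ l ⟧ + k)                           ∎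

  -- The hypothesis concerns coefficients only. One `refl` thus proves a tiling for all values of
  -- `x` and `y`, including those where some segments are empty.
  segments-↭ : ∀ n s l segs → tile n s segs ≡ just (s ⊕ l) → segments segs ↭ interval ⟦ s ⟧ ⟦ l ⟧
  segments-↭ n s l segs eq with tile-sound n s segs eq
  ... | k , σ , end with +-cancelˡ-≡ ⟦ s ⟧ k ⟦ l ⟧ (trans end (⟦⟧-⊕ s l))
  ...   | refl = σ

-- Distances and inequalities

dist-zeroʳ : ∀ m → ∣ m - 0 ∣ ≡ m
dist-zeroʳ zero    = refl
dist-zeroʳ (suc m) = refl

dist-+ʳ : ∀ m k → ∣ m - m + k ∣ ≡ k
dist-+ʳ zero    k = refl
dist-+ʳ (suc m) k = dist-+ʳ m k

dist-+ˡ : ∀ m k → ∣ m + k - m ∣ ≡ k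
dist-+ˡ zero    zero    = refl
dist-+ˡ zero    (suc k) = refl
dist-+ˡ (suc m) k       = dist-+ˡ m k

≤-by : ∀ {m n} s → m + s ≡ n → m ≤ n
≤-by {m} s eq = subst (m ≤_) eq (m≤m+n m s)

-- Extended Langford systems

-- (x , δ) stands for the pair {x, x + δ}.
Pair : Set
Pair = ℕ × ℕ

left diff right : Pair → ℕ
left  (x , δ) = x
diff  (x , δ) = δ
right (x , δ) = x + δ

both : Pair → List ℕ
both p = left p ∷ right p ∷ []

record Langford (q n y : ℕ) : Set where
  field
    pairs       : List Pair
    differences : map diff pairs ↭ interval (suc q) n
    positions   : y ∷ concatMap both pairs ↭ interval 1 (suc (2 * n))

-- Pairs around a common centre, innermost first: going outwards, the left end falls by one and the
-- right end rises by one, so the difference grows by two.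
nest : ℕ → ℕ → ℕ → List Pair
nest l δ zero    = []
nest l δ (suc n) = (l + n , δ) ∷ nest l (2 + δ) n

nest-left : ∀ l δ n → map left (nest l δ n) ↭ interval l n
nest-left l δ zero    = ↭-refl
nest-left l δ (suc n) = ↭-trans (prep (l + n) (nest-left l (2 + δ) n)) (interval-snoc l n)

nest-diff : ∀ l δ n → map diff (nest l δ n) ≡ prog 2 δ n
nest-diff l δ zero    = refl
nest-diff l δ (suc n) = cong (δ ∷_) (nest-diff l (2 + δ) n)

-- The hypothesis expresses the innermost right end `l + (n - 1) + δ` without subtraction; passing
-- to the next pair raises it by one.
nest-right : ∀ l δ n r → suc r ≡ l + n + δ → map right (nest l δ n) ≡ interval r n
nest-right l δ zero    r eq = refl
nest-right l δ (suc n) r eq = cong₂ _∷_ (suc-injective (trans (lemma l n δ) (sym eq))) (nest-right l (2 + δ) n (suc r) (trans (cong suc eq) (lemma′ l n δ)))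
  where
  lemma : ∀ l n δ → suc (l + n + δ) ≡ l + suc n + δ
  lemma = solve-∀
  lemma′ : ∀ l n δ → suc (l + suc n + δ) ≡ l + n + (2 + δ)
  lemma′ = solve-∀

module Blocks (x y : ℕ) where

  open Evaluation x y public

  blocks : {S A : Set} (build : S → List A) (f : A → List ℕ) (shape : S → List Segment) →
           (∀ s → concatMap f (build s) ↭ segments (shape s)) →
           ∀ ss → concatMap f (concatMap build ss) ↭ segments (concatMap shape ss)
  blocks build f shape σ []       = ↭-refl
  blocks build f shape σ (s ∷ ss) = begin
    concatMap f (build s ++ concatMap build ss)                  ≡⟨ concatMap-++ f (build s) (concatMap build ss) ⟩
    concatMap f (build s) ++ concatMap f (concatMap build ss)    ↭⟨ ++⁺ (σ s) (blocks build f shape σ ss) ⟩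
    segments (shape s) ++ segments (concatMap shape ss)          ≡⟨ concatMap-++ segment (shape s) (concatMap shape ss) ⟨
    segments (shape s ++ concatMap shape ss)                     ∎
    where open PermutationReasoning

  -- Turns an identity of coefficients, proved by `refl` in the tables, into the numerical
  -- hypothesis of `nest-right`, `family-u+b` and `family-w+b`.
  ⟦⟧-balance : ∀ l a b c → lin 1 0 0 ⊕ l ≡ a ⊕ b ⊕ c → suc ⟦ l ⟧ ≡ ⟦ a ⟧ + ⟦ b ⟧ + ⟦ c ⟧
  ⟦⟧-balance l a b c eq = begin
    suc ⟦ l ⟧                  ≡⟨ ⟦⟧-⊕ (lin 1 0 0) l ⟨
    ⟦ lin 1 0 0 ⊕ l ⟧          ≡⟨ cong ⟦_⟧ eq ⟩
    ⟦ a ⊕ b ⊕ c ⟧              ≡⟨ ⟦⟧-⊕ (a ⊕ b) c ⟩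
    ⟦ a ⊕ b ⟧ + ⟦ c ⟧          ≡⟨ cong (_+ ⟦ c ⟧) (⟦⟧-⊕ a b) ⟩
    ⟦ a ⟧ + ⟦ b ⟧ + ⟦ c ⟧      ∎
    where open ≡-Reasoning

-- rights is the right end of the innermost pair.
record Nest : Set where
  constructor mkNest
  field
    lefts gap count rights : Lin
    balanced : lin 1 0 0 ⊕ rights ≡ lefts ⊕ count ⊕ gap

module Nests (x y : ℕ) where

  open Blocks x y public
  open Nest

  build : Nest → List Pair
  build ν = nest ⟦ lefts ν ⟧ ⟦ gap ν ⟧ ⟦ count ν ⟧

  shape : Nest → List Segment
  shape ν = (lefts ν , count ν) ∷ (rights ν , count ν) ∷ []

  nests-both : ∀ νs → concatMap both (concatMap build νs) ↭ segments (concatMap shape νs)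
  nests-both = blocks build both shape λ ν → let l = ⟦ lefts ν ⟧; δ = ⟦ gap ν ⟧; n = ⟦ count ν ⟧ in
    ↭-trans (concatMap-transpose (left ∷ right ∷ []) (build ν))
      (++⁺ (nest-left l δ n) (++⁺ (↭-reflexive (nest-right l δ n ⟦ rights ν ⟧
        (⟦⟧-balance (rights ν) (lefts ν) (count ν) (gap ν) (balanced ν)))) ↭-refl))

  nests-diff : ∀ νs → map diff (concatMap build νs) ≡ concatMap (λ ν → prog 2 ⟦ gap ν ⟧ ⟦ count ν ⟧) νs
  nests-diff νs = trans (map-concatMap diff build νs) (concatMap-cong (λ ν → nest-diff ⟦ lefts ν ⟧ ⟦ gap ν ⟧ ⟦ count ν ⟧) νs)

-- Langford systems made of three nests

module _ (q a : ℕ) where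

  open Nests q a

  private
    -- The first nest has the differences q+1, q+3, ...; the other two share q+2, q+4, .... The
    -- names refer to the parity of the number of pairs.
    even odd : List Nest
    even = mkNest (lin 2 1 2) (lin 1 1 0) (lin 0 1 1) (lin 2 3 3) refl
         ∷ mkNest (lin 1 0 0) (lin 2 1 0) (lin 0 0 1) (lin 2 1 1) refl
         ∷ mkNest (lin 1 0 1) (lin 2 1 2) (lin 0 1 0) (lin 2 2 3) refl ∷ []
    odd  = mkNest (lin 2 1 2) (lin 1 1 0) (lin 1 1 1) (lin 3 3 3) refl
         ∷ mkNest (lin 1 0 0) (lin 2 1 0) (lin 0 0 1) (lin 2 1 1) refl
         ∷ mkNest (lin 2 0 1) (lin 2 1 2) (lin 0 1 0) (lin 3 2 3) refl ∷ []

    -- The second nest has a differences beginning with q+2, and the third begins with q+2+2a,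
    -- exactly where that progression continues.
    upper : prog 2 ⟦ lin 2 1 0 ⟧ ⟦ lin 0 0 1 ⟧ ++ prog 2 ⟦ lin 2 1 2 ⟧ ⟦ lin 0 1 0 ⟧ ++ [] ≡ prog 2 ⟦ lin 2 1 0 ⟧ ⟦ lin 0 1 1 ⟧
    upper = begin
      _                                                                              ≡⟨ cong (prog 2 ⟦ lin 2 1 0 ⟧ ⟦ lin 0 0 1 ⟧ ++_) (++-identityʳ _) ⟩
      prog 2 ⟦ lin 2 1 0 ⟧ ⟦ lin 0 0 1 ⟧ ++ prog 2 ⟦ lin 2 1 2 ⟧ ⟦ lin 0 1 0 ⟧       ≡⟨ cong (λ z → prog 2 ⟦ lin 2 1 0 ⟧ ⟦ lin 0 0 1 ⟧ ++ prog 2 z ⟦ lin 0 1 0 ⟧) (e₁ q a) ⟩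
      prog 2 ⟦ lin 2 1 0 ⟧ ⟦ lin 0 0 1 ⟧ ++ prog 2 (⟦ lin 2 1 0 ⟧ + ⟦ lin 0 0 1 ⟧ * 2) ⟦ lin 0 1 0 ⟧  ≡⟨ prog-++ 2 ⟦ lin 2 1 0 ⟧ ⟦ lin 0 0 1 ⟧ ⟦ lin 0 1 0 ⟧ ⟩
      prog 2 ⟦ lin 2 1 0 ⟧ (⟦ lin 0 0 1 ⟧ + ⟦ lin 0 1 0 ⟧)                           ≡⟨ cong (prog 2 ⟦ lin 2 1 0 ⟧) (⟦⟧-⊕ (lin 0 0 1) (lin 0 1 0)) ⟨
      prog 2 ⟦ lin 2 1 0 ⟧ ⟦ lin 0 1 1 ⟧                                             ∎
      where
      open ≡-Reasoning
      e₁ : ∀ q a → 2 + (2 * a + 1 * q) ≡ 2 + (0 * a + 1 * q) + (0 + (1 * a + 0 * q)) * 2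
      e₁ = solve-∀

  langford-even : Langford q (2 * (q + a)) (1 + (q + a))
  langford-even = record
    { pairs = concatMap build even
    ; differences = begin
        map diff (concatMap build even)                                              ≡⟨ nests-diff even ⟩
        prog 2 ⟦ lin 1 1 0 ⟧ ⟦ lin 0 1 1 ⟧ ++ _                                      ≡⟨ cong (prog 2 ⟦ lin 1 1 0 ⟧ ⟦ lin 0 1 1 ⟧ ++_) upper ⟩
        prog 2 ⟦ lin 1 1 0 ⟧ ⟦ lin 0 1 1 ⟧ ++ prog 2 ⟦ lin 2 1 0 ⟧ ⟦ lin 0 1 1 ⟧     ↭⟨ interleave ⟦ lin 1 1 0 ⟧ ⟦ lin 0 1 1 ⟧ ⟩
        interval ⟦ lin 1 1 0 ⟧ (⟦ lin 0 1 1 ⟧ + ⟦ lin 0 1 1 ⟧)                       ≡⟨ cong₂ interval (e₁ q a) (e₂ q a) ⟩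
        interval (suc q) (2 * (q + a))                                               ∎
    ; positions = begin
        1 + (q + a) ∷ concatMap both (concatMap build even)          ≡⟨ cong (_∷ concatMap both (concatMap build even)) (e₃ q a) ⟩
        ⟦ lin 1 1 1 ⟧ ∷ concatMap both (concatMap build even)        ↭⟨ prep _ (nests-both even) ⟩
        -- From left to right: lefts of the second nest, lefts of the third, the hole, rights of the
        -- second, lefts of the first, rights of the third, rights of the first.
        ⟦ lin 1 1 1 ⟧ ∷ segments (concatMap shape even)              ↭⟨ segments-↭ 10 (lin 1 0 0) (lin 1 4 4) ((lin 1 1 1 , lin 1 0 0) ∷ concatMap shape even) refl ⟩
        interval 1 ⟦ lin 1 4 4 ⟧                                     ≡⟨ cong (interval 1) (e₄ q a) ⟩
        interval 1 (suc (2 * (2 * (q + a))))                         ∎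
    }
    where
    open PermutationReasoning
    e₁ : ∀ q a → 1 + (0 * a + 1 * q) ≡ suc q
    e₁ = solve-∀
    e₂ : ∀ q a → 0 + (1 * a + 1 * q) + (0 + (1 * a + 1 * q)) ≡ 2 * (q + a)
    e₂ = solve-∀
    e₃ : ∀ q a → 1 + (q + a) ≡ 1 + (1 * a + 1 * q)
    e₃ = solve-∀
    e₄ : ∀ q a → 1 + (4 * a + 4 * q) ≡ suc (2 * (2 * (q + a)))
    e₄ = solve-∀

  langford-odd : Langford q (1 + 2 * (q + a)) (1 + a)
  langford-odd = record
    { pairs = concatMap build odd
    ; differences = begin
        map diff (concatMap build odd)                                               ≡⟨ nests-diff odd ⟩
        prog 2 ⟦ lin 1 1 0 ⟧ ⟦ lin 1 1 1 ⟧ ++ _                                      ≡⟨ cong (prog 2 ⟦ lin 1 1 0 ⟧ ⟦ lin 1 1 1 ⟧ ++_) upper ⟩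
        prog 2 ⟦ lin 1 1 0 ⟧ ⟦ lin 1 1 1 ⟧ ++ prog 2 ⟦ lin 2 1 0 ⟧ ⟦ lin 0 1 1 ⟧     ↭⟨ interleave-odd ⟦ lin 1 1 0 ⟧ ⟦ lin 0 1 1 ⟧ ⟩
        interval ⟦ lin 1 1 0 ⟧ (suc (⟦ lin 0 1 1 ⟧ + ⟦ lin 0 1 1 ⟧))                 ≡⟨ cong₂ interval (e₁ q a) (e₂ q a) ⟩
        interval (suc q) (1 + 2 * (q + a))                                           ∎
    ; positions = begin
        1 + a ∷ concatMap both (concatMap build odd)                 ≡⟨ cong (_∷ concatMap both (concatMap build odd)) (e₃ q a) ⟩
        ⟦ lin 1 0 1 ⟧ ∷ concatMap both (concatMap build odd)         ↭⟨ prep _ (nests-both odd) ⟩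
        -- The same order, except that the hole precedes the lefts of the third nest.
        ⟦ lin 1 0 1 ⟧ ∷ segments (concatMap shape odd)               ↭⟨ segments-↭ 10 (lin 1 0 0) (lin 3 4 4) ((lin 1 0 1 , lin 1 0 0) ∷ concatMap shape odd) refl ⟩
        interval 1 ⟦ lin 3 4 4 ⟧                                     ≡⟨ cong (interval 1) (e₄ q a) ⟩
        interval 1 (suc (2 * (1 + 2 * (q + a))))                     ∎
    }
    where
    open PermutationReasoning
    e₁ : ∀ q a → 1 + (0 * a + 1 * q) ≡ suc q
    e₁ = solve-∀
    e₂ : ∀ q a → suc (0 + (1 * a + 1 * q) + (0 + (1 * a + 1 * q))) ≡ 1 + 2 * (q + a)
    e₂ = solve-∀
    e₃ : ∀ q a → 1 + a ≡ 1 + (1 * a + 0 * q)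
    e₃ = solve-∀
    e₄ : ∀ q a → 3 + (4 * a + 4 * q) ≡ suc (2 * (1 + 2 * (q + a)))
    e₄ = solve-∀

-- Pentagons with one small edge label

-- The pentagon 0, L+u+b, b, L+w+b, L+d.
record Quad : Set where
  constructor quad
  field u w d b : ℕ
open Quad

topEdges topVertices : Quad → List ℕ
topEdges    p = u p + b p ∷ u p ∷ w p ∷ d p ∷ []
topVertices p = u p + b p ∷ w p + b p ∷ d p ∷ []

gapOf : Quad → ℕ
gapOf p = ∣ w p + b p - d p ∣

-- Labels above L are given relative to L; tops are those available as edge labels, M bounds the
-- vertex labels. The bound inner-< keeps every b below the vertex v of the remaining pentagon.
record Ordinary (q τ M : ℕ) (tops : List ℕ) : Set where
  field
    quads     : List Quad
    gaps      : map gapOf quads ↭ interval 1 q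
    edge-tops   : τ ∷ concatMap topEdges quads ↭ tops
    unused    : List ℕ
    vertex-tops : unused ++ τ ∷ concatMap topVertices quads ↭ interval 1 M
    unused′   : List ℕ
    base size : ℕ
    inner     : unused′ ++ map b quads ↭ interval (suc base) size
    inner-<   : 2 * (base + size) < 3 * q + 6 + τ
    τ-≤       : τ ≤ 2 * q + 2

-- While b rises by two, each of u, w, d falls by one, so u+b and w+b rise by one. These five
-- quantities fill intervals, and the signed gap w+b-d rises by two at each step.
family : ℕ → ℕ → ℕ → ℕ → ℕ → List Quad
family U W D β zero    = []
family U W D β (suc n) = quad (U + n) (W + n) (D + n) β ∷ family U W D (2 + β) n

module _ (U W D : ℕ) where

  family-u : ∀ β n → map u (family U W D β n) ↭ interval U n
  family-u β zero    = ↭-refl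
  family-u β (suc n) = ↭-trans (prep (U + n) (family-u (2 + β) n)) (interval-snoc U n)

  family-w : ∀ β n → map w (family U W D β n) ↭ interval W n
  family-w β zero    = ↭-refl
  family-w β (suc n) = ↭-trans (prep (W + n) (family-w (2 + β) n)) (interval-snoc W n)

  family-d : ∀ β n → map d (family U W D β n) ↭ interval D n
  family-d β zero    = ↭-refl
  family-d β (suc n) = ↭-trans (prep (D + n) (family-d (2 + β) n)) (interval-snoc D n)

  family-b : ∀ β n → map b (family U W D β n) ≡ prog 2 β n
  family-b β zero    = refl
  family-b β (suc n) = cong (β ∷_) (family-b (2 + β) n)

  private
    head : ∀ U n β A → suc A ≡ U + suc n + β → U + n + β ≡ A
    head U n β A eq = suc-injective (trans (lemma U n β) (sym eq))
      where
      lemma : ∀ l n δ → suc (l + n + δ) ≡ l + suc n + δ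
      lemma = solve-∀
    tail : ∀ U n β A → suc A ≡ U + suc n + β → suc (suc A) ≡ U + n + (2 + β)
    tail U n β A eq = trans (cong suc eq) (lemma U n β)
      where
      lemma : ∀ l n δ → suc (l + suc n + δ) ≡ l + n + (2 + δ)
      lemma = solve-∀

  family-u+b : ∀ β n A → suc A ≡ U + n + β → map (λ p → u p + b p) (family U W D β n) ≡ interval A n
  family-u+b β zero    A eq = refl
  family-u+b β (suc n) A eq = cong₂ _∷_ (head U n β A eq) (family-u+b (2 + β) n (suc A) (tail U n β A eq))

  family-w+b : ∀ β n C → suc C ≡ W + n + β → map (λ p → w p + b p) (family U W D β n) ≡ interval C n
  family-w+b β zero    C eq = refl
  family-w+b β (suc n) C eq = cong₂ _∷_ (head W n β C eq) (family-w+b (2 + β) n (suc C) (tail W n β C eq))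

  -- Here w+b lies above d already at the first quad, and the distance grows by two.
  family-gap-up : ∀ β n s → W + β ≡ D + s → map gapOf (family U W D β n) ↭ prog 2 s n
  family-gap-up β zero    s eq = ↭-refl
  family-gap-up β (suc n) s eq =
    ↭-trans (↭-reflexive (cong (_∷ map gapOf (family U W D (2 + β) n)) first)) (prep s (family-gap-up (2 + β) n (2 + s) (step eq)))
    where
    e : ∀ x y z → x + y + z ≡ y + (x + z)
    e = solve-∀
    e′ : ∀ x y z → x + (y + z) ≡ y + x + z
    e′ = solve-∀
    first : ∣ W + n + β - D + n ∣ ≡ s
    first = trans (cong (λ z → ∣ z - D + n ∣) (trans (e W n β) (trans (cong (n +_) eq) (e′ n D s)))) (dist-+ˡ (D + n) s)
    step : W + β ≡ D + s → W + (2 + β) ≡ D + (2 + s)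
    step eq = trans (lemma W β) (trans (cong (2 +_) eq) (sym (lemma D s)))
      where
      lemma : ∀ x y → x + (2 + y) ≡ 2 + (x + y)
      lemma = solve-∀

  -- Here w+b lies below d and approaches it. The first quad has the largest gap, which `prog-snoc`
  -- moves to the end of the progression. The `2 +` in the hypothesis avoids `n - 1`.
  family-gap-down : ∀ β n s → 2 + D ≡ W + β + s + 2 * n → map gapOf (family U W D β n) ↭ prog 2 s n
  family-gap-down β zero    s eq = ↭-refl
  family-gap-down β (suc n) s eq =
    ↭-trans (↭-reflexive (cong (_∷ map gapOf (family U W D (2 + β) n)) first))
      (↭-trans (prep _ (family-gap-down (2 + β) n s (trans eq (step W β s n)))) (prog-snoc 2 s n))
    where
    step : ∀ W β s n → W + β + s + 2 * suc n ≡ W + (2 + β) + s + 2 * n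
    step = solve-∀
    e : ∀ W β s n → W + β + s + 2 * suc n ≡ 2 + (W + β + (s + n * 2))
    e = solve-∀
    D≡ : D ≡ W + β + (s + n * 2)
    D≡ = suc-injective (suc-injective (trans eq (e W β s n)))
    e′ : ∀ W β x n → W + β + x + n ≡ W + n + β + x
    e′ = solve-∀
    first : ∣ W + n + β - D + n ∣ ≡ s + n * 2
    first = trans (cong (λ z → ∣ W + n + β - z ∣) (trans (cong (_+ n) D≡) (e′ W β (s + n * 2) n))) (dist-+ʳ (W + n + β) (s + n * 2))

-- A and C are the least values of u + b and w + b.
record Family : Set where
  constructor mkFamily
  field
    U W D β count A C : Lin
    balanced-A : lin 1 0 0 ⊕ A ≡ U ⊕ count ⊕ β
    balanced-C : lin 1 0 0 ⊕ C ≡ W ⊕ count ⊕ β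

module Families (k : ℕ) where

  open Blocks k 0 public
  open Family

  build : Family → List Quad
  build φ = family ⟦ U φ ⟧ ⟦ W φ ⟧ ⟦ D φ ⟧ ⟦ β φ ⟧ ⟦ count φ ⟧

  edgeShape vertexShape : Family → List Segment
  edgeShape   φ = (A φ , count φ) ∷ (U φ , count φ) ∷ (W φ , count φ) ∷ (D φ , count φ) ∷ []
  vertexShape φ = (A φ , count φ) ∷ (C φ , count φ) ∷ (D φ , count φ) ∷ []

  private
    module _ (φ : Family) where
      u′ = family-u ⟦ U φ ⟧ ⟦ W φ ⟧ ⟦ D φ ⟧ ⟦ β φ ⟧ ⟦ count φ ⟧
      w′ = family-w ⟦ U φ ⟧ ⟦ W φ ⟧ ⟦ D φ ⟧ ⟦ β φ ⟧ ⟦ count φ ⟧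
      d′ = family-d ⟦ U φ ⟧ ⟦ W φ ⟧ ⟦ D φ ⟧ ⟦ β φ ⟧ ⟦ count φ ⟧
      u+b′ = ↭-reflexive (family-u+b ⟦ U φ ⟧ ⟦ W φ ⟧ ⟦ D φ ⟧ ⟦ β φ ⟧ ⟦ count φ ⟧ ⟦ A φ ⟧ (⟦⟧-balance (A φ) (U φ) (count φ) (β φ) (balanced-A φ)))
      w+b′ = ↭-reflexive (family-w+b ⟦ U φ ⟧ ⟦ W φ ⟧ ⟦ D φ ⟧ ⟦ β φ ⟧ ⟦ count φ ⟧ ⟦ C φ ⟧ (⟦⟧-balance (C φ) (W φ) (count φ) (β φ) (balanced-C φ)))

  families-edges : ∀ φs → concatMap topEdges (concatMap build φs) ↭ segments (concatMap edgeShape φs)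
  families-edges = blocks build topEdges edgeShape λ φ →
    ↭-trans (concatMap-transpose ((λ p → u p + b p) ∷ u ∷ w ∷ d ∷ []) (build φ)) (++⁺ (u+b′ φ) (++⁺ (u′ φ) (++⁺ (w′ φ) (++⁺ (d′ φ) ↭-refl))))

  families-vertices : ∀ φs → concatMap topVertices (concatMap build φs) ↭ segments (concatMap vertexShape φs)
  families-vertices = blocks build topVertices vertexShape λ φ →
    ↭-trans (concatMap-transpose ((λ p → u p + b p) ∷ (λ p → w p + b p) ∷ d ∷ []) (build φ)) (++⁺ (u+b′ φ) (++⁺ (w+b′ φ) (++⁺ (d′ φ) ↭-refl)))

  families-b : ∀ φs → map b (concatMap build φs) ≡ concatMap (λ φ → prog 2 ⟦ β φ ⟧ ⟦ count φ ⟧) φs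
  families-b φs = trans (map-concatMap b build φs) (concatMap-cong (λ φ → family-b ⟦ U φ ⟧ ⟦ W φ ⟧ ⟦ D φ ⟧ ⟦ β φ ⟧ ⟦ count φ ⟧) φs)

  tiled : (f : Quad → List ℕ) (shape : Family → List Segment) →
          (∀ φs → concatMap f (concatMap build φs) ↭ segments (concatMap shape φs)) →
          ∀ τ l ss φs → tile 20 one (ss ++ (τ , one) ∷ concatMap shape φs) ≡ just (one ⊕ l) →
          segments ss ++ ⟦ τ ⟧ ∷ concatMap f (concatMap build φs) ↭ interval 1 ⟦ l ⟧
  tiled f shape σ τ l ss φs eq = begin
    segments ss ++ ⟦ τ ⟧ ∷ concatMap f (concatMap build φs)    ↭⟨ ++⁺ˡ (segments ss) (prep ⟦ τ ⟧ (σ φs)) ⟩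
    segments ss ++ segments ((τ , one) ∷ concatMap shape φs)   ≡⟨ concatMap-++ segment ss _ ⟨
    segments (ss ++ (τ , one) ∷ concatMap shape φs)            ↭⟨ segments-↭ 20 one l (ss ++ (τ , one) ∷ concatMap shape φs) eq ⟩
    interval 1 ⟦ l ⟧                                           ∎
    where open PermutationReasoning

-- The ordinary pentagons for each residue of q modulo 4

module _ (k : ℕ) where

  open Families k

  private
    -- The tables were found by computer search. The index is q mod 4; families with count one are
    -- the exceptional pentagons. ψ lists the labels above L that are not vertex labels.
    φ₀ φ₁ φ₂ φ₃ : List Family
    φ₀ = mkFamily (lin 10 10 0) (lin 16 16 0) (lin 18 16 0) (lin 1 0 0) one          (lin 11 10 0) (lin 17 16 0) refl refl
       ∷ mkFamily (lin 7 6 0)   (lin 1 0 0)   (lin 4 4 0)   (lin 5 4 0) (lin 2 2 0)  (lin 13 12 0) (lin 7 6 0)   refl refl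
       ∷ mkFamily (lin 9 8 0)   (lin 3 2 0)   (lin 12 10 0) (lin 6 4 0) (lin 1 2 0)  (lin 15 14 0) (lin 9 8 0)   refl refl
       ∷ []
    φ₁ = mkFamily (lin 2 6 0)   (lin 3 10 0)  (lin 6 16 0)  (lin 2 6 0) one          (lin 4 12 0)  (lin 5 16 0)  refl refl
       ∷ mkFamily (lin 4 10 0)  (lin 1 2 0)   (lin 3 8 0)   (lin 2 2 0) (lin 0 2 0)  (lin 5 14 0)  (lin 2 6 0)   refl refl
       ∷ mkFamily (lin 1 0 0)   (lin 3 6 0)   (lin 5 12 0)  (lin 1 2 0) (lin 0 2 0)  (lin 1 4 0)   (lin 3 10 0)  refl refl
       ∷ []
    φ₂ = mkFamily (lin 7 10 0)  (lin 4 6 0)   (lin 6 8 0)   (lin 1 2 0) one          (lin 8 12 0)  (lin 5 8 0)   refl refl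
       ∷ mkFamily (lin 1 0 0)   (lin 5 6 0)   (lin 9 12 0)  (lin 2 2 0) (lin 1 2 0)  (lin 3 4 0)   (lin 7 10 0)  refl refl
       ∷ mkFamily (lin 8 10 0)  (lin 3 2 0)   (lin 7 8 0)   (lin 3 2 0) (lin 0 2 0)  (lin 10 14 0) (lin 5 6 0)   refl refl
       ∷ []
    φ₃ = mkFamily (lin 7 8 0)   (lin 2 2 0)   (lin 9 10 0)  (lin 4 4 0) (lin 2 2 0)  (lin 12 14 0) (lin 7 8 0)   refl refl
       ∷ mkFamily (lin 6 6 0)   (lin 1 0 0)   (lin 4 4 0)   (lin 5 4 0) (lin 1 2 0)  (lin 11 12 0) (lin 6 6 0)   refl refl
       ∷ []

    ψ₀ ψ₁ ψ₂ ψ₃ : List Segment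
    ψ₀ = (one , lin 3 4 0) ∷ (lin 10 10 0 , one) ∷ (lin 16 16 0 , one) ∷ []
    ψ₁ = (one , lin 0 4 0) ∷ (lin 2 8 0 , one) ∷ (lin 3 12 0 , one) ∷ []
    ψ₂ = (one , lin 1 2 0) ∷ (lin 3 2 0 , lin 0 2 0) ∷ (lin 4 6 0 , one) ∷ []
    ψ₃ = (one , lin 3 4 0) ∷ []

  -- Two families suffice: the first has the odd gaps, the second the even ones, and likewise the
  -- inner labels of the two alternate in parity.
  ordinary₃ : Ordinary (3 + 4 * k) (5 + 6 * k) (13 + 16 * k) (interval 1 (13 + 16 * k))
  ordinary₃ = record
    { quads = concatMap build φ₃
    ; gaps = begin
        map gapOf (concatMap build φ₃)                             ≡⟨ map-concatMap gapOf build φ₃ ⟩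
        concatMap (map gapOf ∘ build) φ₃                           ↭⟨ ++⁺ (family-gap-down (7 + 8 * k) (2 + 2 * k) (9 + 10 * k) (4 + 4 * k) (2 + 2 * k) 1 (g₁ k))
                                                                     (++⁺ (family-gap-up (6 + 6 * k) 1 (4 + 4 * k) (5 + 4 * k) (1 + 2 * k) 2 (g₂ k)) ↭-refl) ⟩
        prog 2 1 (2 + 2 * k) ++ prog 2 2 (1 + 2 * k) ++ []         ≡⟨ cong (prog 2 1 (2 + 2 * k) ++_) (++-identityʳ _) ⟩
        prog 2 1 (2 + 2 * k) ++ prog 2 2 (1 + 2 * k)               ↭⟨ interleave-odd 1 (1 + 2 * k) ⟩
        interval 1 (suc (1 + 2 * k + (1 + 2 * k)))                 ≡⟨ cong (interval 1) (g₃ k) ⟩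
        interval 1 (3 + 4 * k)                                     ∎
    ; edge-tops = tiled topEdges edgeShape families-edges (lin 5 6 0) (lin 13 16 0) [] φ₃ refl
    ; vertex-tops = tiled topVertices vertexShape families-vertices (lin 5 6 0) (lin 13 16 0) ψ₃ φ₃ refl
    ; unused = segments ψ₃
    ; unused′ = []
    ; base = 3 + 4 * k
    ; size = 3 + 4 * k
    ; inner = begin
        map b (concatMap build φ₃)                                          ≡⟨ families-b φ₃ ⟩
        prog 2 (4 + 4 * k) (2 + 2 * k) ++ prog 2 (5 + 4 * k) (1 + 2 * k) ++ []  ≡⟨ cong (prog 2 (4 + 4 * k) (2 + 2 * k) ++_) (++-identityʳ _) ⟩
        prog 2 (4 + 4 * k) (2 + 2 * k) ++ prog 2 (5 + 4 * k) (1 + 2 * k)    ↭⟨ interleave-odd (4 + 4 * k) (1 + 2 * k) ⟩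
        interval (4 + 4 * k) (suc (1 + 2 * k + (1 + 2 * k)))                ≡⟨ cong (interval (4 + 4 * k)) (g₃ k) ⟩
        interval (4 + 4 * k) (3 + 4 * k)                                    ∎
    ; inner-< = ≤-by (7 + 2 * k) (g₄ k)
    ; τ-≤ = ≤-by (3 + 2 * k) (g₅ k)
    }
    where
    open PermutationReasoning
    g₁ : ∀ k → 2 + (9 + 10 * k) ≡ 2 + 2 * k + (4 + 4 * k) + 1 + 2 * (2 + 2 * k)
    g₁ = solve-∀
    g₂ : ∀ k → 1 + (5 + 4 * k) ≡ 4 + 4 * k + 2
    g₂ = solve-∀
    g₃ : ∀ k → suc (1 + 2 * k + (1 + 2 * k)) ≡ 3 + 4 * k
    g₃ = solve-∀
    g₄ : ∀ k → suc (2 * (3 + 4 * k + (3 + 4 * k))) + (7 + 2 * k) ≡ 3 * (3 + 4 * k) + 6 + (5 + 6 * k)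
    g₄ = solve-∀
    g₅ : ∀ k → 5 + 6 * k + (3 + 2 * k) ≡ 2 * (3 + 4 * k) + 2
    g₅ = solve-∀

  -- The exceptional pentagon has gap 1, the second family the even gaps, the third the odd gaps
  -- from 3 on; the next two cases follow the same pattern. Counting starts at q = 4, as q = 0 has
  -- no ordinary pentagon.
  ordinary₀ : Ordinary (4 + 4 * k) (6 + 6 * k) (18 + 16 * k) (hooked (16 + 16 * k))
  ordinary₀ = record
    { quads = concatMap build φ₀
    ; gaps = begin
        map gapOf (concatMap build φ₀)                             ≡⟨ map-concatMap gapOf build φ₀ ⟩
        concatMap (map gapOf ∘ build) φ₀                           ↭⟨ ++⁺ (family-gap-down (10 + 10 * k) (16 + 16 * k) (18 + 16 * k) 1 1 1 (g₁ k))
                                                                     (++⁺ (family-gap-up (7 + 6 * k) 1 (4 + 4 * k) (5 + 4 * k) (2 + 2 * k) 2 (g₂ k))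
                                                                     (++⁺ (family-gap-down (9 + 8 * k) (3 + 2 * k) (12 + 10 * k) (6 + 4 * k) (1 + 2 * k) 3 (g₃ k)) ↭-refl)) ⟩
        1 ∷ prog 2 2 (2 + 2 * k) ++ prog 2 3 (1 + 2 * k) ++ []     ≡⟨ cong (λ z → 1 ∷ prog 2 2 (2 + 2 * k) ++ z) (++-identityʳ _) ⟩
        1 ∷ prog 2 2 (2 + 2 * k) ++ prog 2 3 (1 + 2 * k)           ↭⟨ prep 1 (interleave-odd 2 (1 + 2 * k)) ⟩
        interval 1 (2 + (1 + 2 * k + (1 + 2 * k)))                 ≡⟨ cong (interval 1) (g₄ k) ⟩
        interval 1 (4 + 4 * k)                                     ∎
    -- The extra segment is the hole 4q+1.
    ; edge-tops = unhook (16 + 16 * k) (tiled topEdges edgeShape families-edges (lin 6 6 0) (lin 18 16 0) ((lin 17 16 0 , one) ∷ []) φ₀ refl)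
    ; vertex-tops = tiled topVertices vertexShape families-vertices (lin 6 6 0) (lin 18 16 0) ψ₀ φ₀ refl
    ; unused = segments ψ₀
    -- The inner labels are 1 and 5+4k, ..., 7+8k; these are the numbers in between.
    ; unused′ = interval 2 (3 + 4 * k)
    ; base = 0
    ; size = 7 + 8 * k
    ; inner = begin
        interval 2 (3 + 4 * k) ++ map b (concatMap build φ₀)                            ≡⟨ cong (interval 2 (3 + 4 * k) ++_) (families-b φ₀) ⟩
        interval 2 (3 + 4 * k) ++ 1 ∷ prog 2 (5 + 4 * k) (2 + 2 * k) ++ prog 2 (6 + 4 * k) (1 + 2 * k) ++ []
          ≡⟨ cong (λ z → interval 2 (3 + 4 * k) ++ 1 ∷ prog 2 (5 + 4 * k) (2 + 2 * k) ++ z) (++-identityʳ _) ⟩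
        interval 2 (3 + 4 * k) ++ 1 ∷ prog 2 (5 + 4 * k) (2 + 2 * k) ++ prog 2 (6 + 4 * k) (1 + 2 * k)
          ↭⟨ ++⁺ˡ (interval 2 (3 + 4 * k)) (prep 1 (interleave-odd (5 + 4 * k) (1 + 2 * k))) ⟩
        interval 2 (3 + 4 * k) ++ 1 ∷ interval (5 + 4 * k) (suc (1 + 2 * k + (1 + 2 * k)))
          ≡⟨ cong₂ (λ y z → interval 2 (3 + 4 * k) ++ 1 ∷ interval y z) refl (g₅ k) ⟩
        interval 2 (3 + 4 * k) ++ 1 ∷ interval (5 + 4 * k) (3 + 4 * k)
          ↭⟨ shift 1 (interval 2 (3 + 4 * k)) _ ⟩
        interval 1 (4 + 4 * k) ++ interval (1 + (4 + 4 * k)) (3 + 4 * k)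
          ≡⟨ interval-++ 1 (4 + 4 * k) (3 + 4 * k) ⟩
        interval 1 (4 + 4 * k + (3 + 4 * k))                                            ≡⟨ cong (interval 1) (g₆ k) ⟩
        interval 1 (7 + 8 * k)                                                          ∎
    ; inner-< = ≤-by (9 + 2 * k) (g₇ k)
    ; τ-≤ = ≤-by (4 + 2 * k) (g₈ k)
    }
    where
    open PermutationReasoning
    g₁ : ∀ k → 2 + (18 + 16 * k) ≡ 16 + 16 * k + 1 + 1 + 2 * 1
    g₁ = solve-∀
    g₂ : ∀ k → 1 + (5 + 4 * k) ≡ 4 + 4 * k + 2
    g₂ = solve-∀
    g₃ : ∀ k → 2 + (12 + 10 * k) ≡ 3 + 2 * k + (6 + 4 * k) + 3 + 2 * (1 + 2 * k)
    g₃ = solve-∀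
    g₄ : ∀ k → 2 + (1 + 2 * k + (1 + 2 * k)) ≡ 4 + 4 * k
    g₄ = solve-∀
    g₅ : ∀ k → suc (1 + 2 * k + (1 + 2 * k)) ≡ 3 + 4 * k
    g₅ = solve-∀
    g₆ : ∀ k → 4 + 4 * k + (3 + 4 * k) ≡ 7 + 8 * k
    g₆ = solve-∀
    g₇ : ∀ k → suc (2 * (7 + 8 * k)) + (9 + 2 * k) ≡ 3 * (4 + 4 * k) + 6 + (6 + 6 * k)
    g₇ = solve-∀
    g₈ : ∀ k → 6 + 6 * k + (4 + 2 * k) ≡ 2 * (4 + 4 * k) + 2
    g₈ = solve-∀

  ordinary₁ : Ordinary (1 + 4 * k) (1 + 6 * k) (6 + 16 * k) (hooked (4 + 16 * k))
  ordinary₁ = record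
    { quads = concatMap build φ₁
    ; gaps = begin
        map gapOf (concatMap build φ₁)                             ≡⟨ map-concatMap gapOf build φ₁ ⟩
        concatMap (map gapOf ∘ build) φ₁                           ↭⟨ ++⁺ (family-gap-down (2 + 6 * k) (3 + 10 * k) (6 + 16 * k) (2 + 6 * k) 1 1 (g₁ k))
                                                                     (++⁺ (family-gap-down (4 + 10 * k) (1 + 2 * k) (3 + 8 * k) (2 + 2 * k) (2 * k) 2 (g₂ k))
                                                                     (++⁺ (family-gap-down 1 (3 + 6 * k) (5 + 12 * k) (1 + 2 * k) (2 * k) 3 (g₃ k)) ↭-refl)) ⟩
        1 ∷ prog 2 2 (2 * k) ++ prog 2 3 (2 * k) ++ []             ≡⟨ cong (λ z → 1 ∷ prog 2 2 (2 * k) ++ z) (++-identityʳ _) ⟩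
        1 ∷ prog 2 2 (2 * k) ++ prog 2 3 (2 * k)                   ↭⟨ prep 1 (interleave 2 (2 * k)) ⟩
        interval 1 (1 + (2 * k + 2 * k))                           ≡⟨ cong (interval 1) (g₄ k) ⟩
        interval 1 (1 + 4 * k)                                     ∎
    ; edge-tops = unhook (4 + 16 * k) (tiled topEdges edgeShape families-edges (lin 1 6 0) (lin 6 16 0) ((lin 5 16 0 , one) ∷ []) φ₁ refl)
    ; vertex-tops = tiled topVertices vertexShape families-vertices (lin 1 6 0) (lin 6 16 0) ψ₁ φ₁ refl
    ; unused = segments ψ₁
    -- The two long families occupy 1+2k, ..., 6k and the exceptional pentagon 2+6k, which leaves
    -- one number out.
    ; unused′ = (1 + 6 * k) ∷ []
    ; base = 2 * k
    ; size = 2 + 4 * k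
    ; inner = begin
        (1 + 6 * k) ∷ map b (concatMap build φ₁)                   ≡⟨ cong (1 + 6 * k ∷_) (families-b φ₁) ⟩
        (1 + 6 * k) ∷ (2 + 6 * k) ∷ prog 2 (2 + 2 * k) (2 * k) ++ prog 2 (1 + 2 * k) (2 * k) ++ []
          ≡⟨ cong (λ z → (1 + 6 * k) ∷ (2 + 6 * k) ∷ prog 2 (2 + 2 * k) (2 * k) ++ z) (++-identityʳ _) ⟩
        interval (1 + 6 * k) 2 ++ prog 2 (2 + 2 * k) (2 * k) ++ prog 2 (1 + 2 * k) (2 * k)
          ↭⟨ ++⁺ˡ (interval (1 + 6 * k) 2) (↭-trans (++-comm (prog 2 (2 + 2 * k) (2 * k)) _) (interleave (1 + 2 * k) (2 * k))) ⟩
        interval (1 + 6 * k) 2 ++ interval (1 + 2 * k) (2 * k + 2 * k)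
          ↭⟨ ++-comm (interval (1 + 6 * k) 2) _ ⟩
        interval (1 + 2 * k) (2 * k + 2 * k) ++ interval (1 + 6 * k) 2
          ≡⟨ cong (λ z → interval (1 + 2 * k) (2 * k + 2 * k) ++ interval z 2) (g₅ k) ⟩
        interval (1 + 2 * k) (2 * k + 2 * k) ++ interval (1 + 2 * k + (2 * k + 2 * k)) 2
          ≡⟨ interval-++ (1 + 2 * k) (2 * k + 2 * k) 2 ⟩
        interval (1 + 2 * k) (2 * k + 2 * k + 2)                   ≡⟨ cong (interval (1 + 2 * k)) (g₆ k) ⟩
        interval (1 + 2 * k) (2 + 4 * k)                           ∎
    ; inner-< = ≤-by (5 + 6 * k) (g₇ k)
    ; τ-≤ = ≤-by (3 + 2 * k) (g₈ k)
    }
    where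
    open PermutationReasoning
    g₁ : ∀ k → 2 + (6 + 16 * k) ≡ 3 + 10 * k + (2 + 6 * k) + 1 + 2 * 1
    g₁ = solve-∀
    g₂ : ∀ k → 2 + (3 + 8 * k) ≡ 1 + 2 * k + (2 + 2 * k) + 2 + 2 * (2 * k)
    g₂ = solve-∀
    g₃ : ∀ k → 2 + (5 + 12 * k) ≡ 3 + 6 * k + (1 + 2 * k) + 3 + 2 * (2 * k)
    g₃ = solve-∀
    g₄ : ∀ k → 1 + (2 * k + 2 * k) ≡ 1 + 4 * k
    g₄ = solve-∀
    g₅ : ∀ k → 1 + 6 * k ≡ 1 + 2 * k + (2 * k + 2 * k)
    g₅ = solve-∀
    g₆ : ∀ k → 2 * k + 2 * k + 2 ≡ 2 + 4 * k
    g₆ = solve-∀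
    g₇ : ∀ k → suc (2 * (2 * k + (2 + 4 * k))) + (5 + 6 * k) ≡ 3 * (1 + 4 * k) + 6 + (1 + 6 * k)
    g₇ = solve-∀
    g₈ : ∀ k → 1 + 6 * k + (3 + 2 * k) ≡ 2 * (1 + 4 * k) + 2
    g₈ = solve-∀

  ordinary₂ : Ordinary (2 + 4 * k) (2 + 2 * k) (9 + 16 * k) (interval 1 (9 + 16 * k))
  ordinary₂ = record
    { quads = concatMap build φ₂
    ; gaps = begin
        map gapOf (concatMap build φ₂)                             ≡⟨ map-concatMap gapOf build φ₂ ⟩
        concatMap (map gapOf ∘ build) φ₂                           ↭⟨ ++⁺ (family-gap-down (7 + 10 * k) (4 + 6 * k) (6 + 8 * k) (1 + 2 * k) 1 1 (g₁ k))
                                                                     (++⁺ (family-gap-down 1 (5 + 6 * k) (9 + 12 * k) (2 + 2 * k) (1 + 2 * k) 2 (g₂ k))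
                                                                     (++⁺ (family-gap-down (8 + 10 * k) (3 + 2 * k) (7 + 8 * k) (3 + 2 * k) (2 * k) 3 (g₃ k)) ↭-refl)) ⟩
        1 ∷ prog 2 2 (1 + 2 * k) ++ prog 2 3 (2 * k) ++ []         ≡⟨ cong (λ z → 1 ∷ prog 2 2 (1 + 2 * k) ++ z) (++-identityʳ _) ⟩
        1 ∷ prog 2 2 (1 + 2 * k) ++ prog 2 3 (2 * k)               ↭⟨ prep 1 (interleave-odd 2 (2 * k)) ⟩
        interval 1 (2 + (2 * k + 2 * k))                           ≡⟨ cong (interval 1) (g₄ k) ⟩
        interval 1 (2 + 4 * k)                                     ∎
    ; edge-tops = tiled topEdges edgeShape families-edges (lin 2 2 0) (lin 9 16 0) [] φ₂ refl
    ; vertex-tops = tiled topVertices vertexShape families-vertices (lin 2 2 0) (lin 9 16 0) ψ₂ φ₂ refl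
    ; unused = segments ψ₂
    ; unused′ = []
    ; base = 2 * k
    ; size = 2 + 4 * k
    ; inner = begin
        map b (concatMap build φ₂)                                 ≡⟨ families-b φ₂ ⟩
        (1 + 2 * k) ∷ prog 2 (2 + 2 * k) (1 + 2 * k) ++ prog 2 (3 + 2 * k) (2 * k) ++ []
          ≡⟨ cong (λ z → (1 + 2 * k) ∷ prog 2 (2 + 2 * k) (1 + 2 * k) ++ z) (++-identityʳ _) ⟩
        (1 + 2 * k) ∷ prog 2 (2 + 2 * k) (1 + 2 * k) ++ prog 2 (3 + 2 * k) (2 * k)
          ↭⟨ prep (1 + 2 * k) (interleave-odd (2 + 2 * k) (2 * k)) ⟩
        interval (1 + 2 * k) (2 + (2 * k + 2 * k))                 ≡⟨ cong (interval (1 + 2 * k)) (g₄ k) ⟩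
        interval (1 + 2 * k) (2 + 4 * k)                           ∎
    ; inner-< = ≤-by (9 + 2 * k) (g₇ k)
    ; τ-≤ = ≤-by (4 + 6 * k) (g₈ k)
    }
    where
    open PermutationReasoning
    g₁ : ∀ k → 2 + (6 + 8 * k) ≡ 4 + 6 * k + (1 + 2 * k) + 1 + 2 * 1
    g₁ = solve-∀
    g₂ : ∀ k → 2 + (9 + 12 * k) ≡ 5 + 6 * k + (2 + 2 * k) + 2 + 2 * (1 + 2 * k)
    g₂ = solve-∀
    g₃ : ∀ k → 2 + (7 + 8 * k) ≡ 3 + 2 * k + (3 + 2 * k) + 3 + 2 * (2 * k)
    g₃ = solve-∀
    g₄ : ∀ k → 2 + (2 * k + 2 * k) ≡ 2 + 4 * k
    g₄ = solve-∀
    g₇ : ∀ k → suc (2 * (2 * k + (2 + 4 * k))) + (9 + 2 * k) ≡ 3 * (2 + 4 * k) + 6 + (2 + 2 * k)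
    g₇ = solve-∀
    g₈ : ∀ k → 2 + 2 * k + (4 + 6 * k) ≡ 2 * (2 + 4 * k) + 2
    g₈ = solve-∀

-- For p = 1 the special pentagon is the only one. Its T = L+2 is the single label above L, and L+1
-- is the hole of the near graceful labelling.
ordinary-none : Ordinary 0 2 2 (hooked 0)
ordinary-none = record
  { quads = [] ; gaps = ↭-refl ; edge-tops = ↭-refl ; unused = 1 ∷ [] ; vertex-tops = ↭-refl
  ; unused′ = [] ; base = 0 ; size = 0 ; inner = ↭-refl ; inner-< = s≤s z≤n ; τ-≤ = ≤-by 0 refl }

private module ↭-Solver = CommutativeMonoidSolver (++-commutativeMonoid {A = ℕ})

-- Assembling the labelling

-- After cancelling N, `midpoint` says T - Y = 2v. The lower bound on v puts it above all inner
-- labels b; the upper bound is v ≤ N, which separates it from the triangle labels.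
module Assembly {q t y τ v M : ℕ} {tops : List ℕ} (Λ : Langford q (suc t) y) (Ω : Ordinary q τ M tops)
  (midpoint : y + 2 * v ≡ suc (2 * suc t) + τ) (v-≥ : 3 * q + 6 + τ ≤ 2 * v) (v-≤ : v ≤ q + suc t) where

  open Langford Λ
  open Ordinary Ω
  open Quad

  N L R : ℕ
  N = q + suc t
  L = N + suc (2 * suc t)
  R = y + v

  private
    τ≤v : τ ≤ v
    τ≤v = *-cancelˡ-≤ 2 (begin
      2 * τ                   ≡⟨ e₁ τ ⟩
      τ + τ                   ≤⟨ +-monoˡ-≤ τ τ-≤ ⟩
      2 * q + 2 + τ           ≤⟨ ≤-by (q + 4) (e₂ q τ) ⟩
      3 * q + 6 + τ           ≤⟨ v-≥ ⟩
      2 * v                   ∎)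
      where
      open ≤-Reasoning
      e₁ : ∀ τ → 2 * τ ≡ τ + τ
      e₁ = solve-∀
      e₂ : ∀ q τ → 2 * q + 2 + τ + (q + 4) ≡ 3 * q + 6 + τ
      e₂ = solve-∀

    0<v : 0 < v
    0<v = *-cancelˡ-< 2 0 v (≤-trans (≤-by (3 * q + 5 + τ) (e q τ)) v-≥)
      where
      e : ∀ q τ → 1 + (3 * q + 5 + τ) ≡ 3 * q + 6 + τ
      e = solve-∀

    -- From τ ≤ v it follows that R + τ ≤ R + v = y + 2v, which is the last position plus τ.
    R-≤ : R < suc (suc (2 * suc t))
    R-≤ = s≤s (+-cancelʳ-≤ τ R (suc (2 * suc t)) (begin
      y + v + τ               ≤⟨ +-monoʳ-≤ (y + v) τ≤v ⟩
      y + v + v               ≡⟨ e y v ⟩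
      y + 2 * v               ≡⟨ midpoint ⟩
      suc (2 * suc t) + τ     ∎))
      where
      open ≤-Reasoning
      e : ∀ y v → y + v + v ≡ y + 2 * v
      e = solve-∀

    R≢y : R ≢ y
    R≢y eq = <-irrefl (sym (m+n≡m⇒n≡0 y v eq)) 0<v
      where
      m+n≡m⇒n≡0 : ∀ m n → m + n ≡ m → n ≡ 0
      m+n≡m⇒n≡0 m n eq = +-cancelˡ-≡ m n 0 (trans eq (sym (+-identityʳ m)))

    -- R is a position, and v > 0 makes it different from the hole y; so some pair covers it.
    R∈ : R ∈ concatMap both pairs
    R∈ with ∈-resp-↭ (↭-sym positions) (∈-interval 1 (suc (2 * suc t)) (≤-trans 0<v (m≤n+m v y)) R-≤)
    ... | here eq   = contradiction eq R≢y
    ... | there R∈′ = R∈′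

    -- R may be the left or the right end of its pair. Only the other end R̄ and the undirected
    -- distance matter, so both cases get the same form.
    Split : Set
    Split = ∃₂ λ p rest → pairs ↭ p ∷ rest × ∃ λ R̄ → both p ↭ R ∷ R̄ ∷ [] × ∣ N + R - N + R̄ ∣ ≡ diff p

    mate : ∀ p → R ∈ both p → ∃ λ R̄ → both p ↭ R ∷ R̄ ∷ [] × ∣ N + R - N + R̄ ∣ ≡ diff p
    mate p (here eq) = right p , ↭-reflexive (cong (_∷ right p ∷ []) (sym eq)) ,
      trans (cong₂ (λ a b → ∣ N + a - b ∣) eq (sym (+-assoc N (left p) (diff p)))) (dist-+ʳ (N + left p) (diff p))
    mate p (there (here eq)) = left p , ↭-trans (swap _ _ ↭-refl) (↭-reflexive (cong (_∷ left p ∷ []) (sym eq))) ,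
      trans (cong (λ a → ∣ a - N + left p ∣) (trans (cong (N +_) eq) (sym (+-assoc N (left p) (diff p))))) (dist-+ˡ (N + left p) (diff p))

    split : Split
    split with find (∈-concatMap⁻ both {xs = pairs} R∈)
    ... | p , p∈ , R∈p with ∈-∃++ p∈
    ...   | xs , ys , eq = p , xs ++ ys , ↭-trans (↭-reflexive eq) (shift p xs ys) , mate p R∈p

    p₀ : Pair
    p₀ = proj₁ split

    rest : List Pair
    rest = proj₁ (proj₂ split)

    pairs-↭ : pairs ↭ p₀ ∷ rest
    pairs-↭ = proj₁ (proj₂ (proj₂ split))

    R̄ : ℕ
    R̄ = proj₁ (proj₂ (proj₂ (proj₂ split)))

    both-p₀ : both p₀ ↭ R ∷ R̄ ∷ []
    both-p₀ = proj₁ (proj₂ (proj₂ (proj₂ (proj₂ split))))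

    dist-R̄ : ∣ N + R - N + R̄ ∣ ≡ diff p₀
    dist-R̄ = proj₂ (proj₂ (proj₂ (proj₂ (proj₂ split))))

    triangle : Pair → Triangle
    triangle p = N + left p , N + right p

    special : Pentagon
    special = L + τ , v , N + R , N + R̄

    pentagon : Quad → Pentagon
    pentagon p = L + (u p + b p) , b p , L + (w p + b p) , L + d p

  triangles : List Triangle
  triangles = map triangle rest

  pentagons : List Pentagon
  pentagons = special ∷ map pentagon quads

  length-triangles : length triangles ≡ t
  length-triangles = suc-injective (begin
    suc (length (map triangle rest))   ≡⟨ cong suc (length-map triangle rest) ⟩
    length (p₀ ∷ rest)                 ≡⟨ ↭-length pairs-↭ ⟨
    length pairs                       ≡⟨ length-map diff pairs ⟨
    length (map diff pairs)            ≡⟨ ↭-length differences ⟩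
    length (interval (suc q) (suc t))  ≡⟨ length-prog 1 (suc q) (suc t) ⟩
    suc t                              ∎)
    where open ≡-Reasoning

  length-pentagons : length pentagons ≡ suc q
  length-pentagons = cong suc (begin
    length (map pentagon quads)  ≡⟨ length-map pentagon quads ⟩
    length quads                 ≡⟨ length-map gapOf quads ⟨
    length (map gapOf quads)     ≡⟨ ↭-length gaps ⟩
    length (interval 1 q)        ≡⟨ length-prog 1 1 q ⟩
    q                            ∎)
    where open ≡-Reasoning

  private
    all-positions : y ∷ R ∷ R̄ ∷ concatMap both rest ↭ interval 1 (suc (2 * suc t))
    all-positions = begin
      y ∷ R ∷ R̄ ∷ concatMap both rest     ↭⟨ prep y (++⁺ʳ (concatMap both rest) both-p₀) ⟨
      y ∷ concatMap both (p₀ ∷ rest)      ↭⟨ prep y (concatMap⁺ pairs-↭) ⟨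
      y ∷ concatMap both pairs            ↭⟨ positions ⟩
      interval 1 (suc (2 * suc t))        ∎
      where
      open PermutationReasoning
      concatMap⁺ : ∀ {ps qs} → ps ↭ qs → concatMap both ps ↭ concatMap both qs
      concatMap⁺ _↭_.refl          = ↭-refl
      concatMap⁺ (prep p σ)        = ++⁺ˡ (both p) (concatMap⁺ σ)
      concatMap⁺ (swap p p′ σ)   = ↭-trans (shifts (both p) (both p′)) (++⁺ˡ (both p′) (++⁺ˡ (both p) (concatMap⁺ σ)))
      concatMap⁺ (_↭_.trans σ ρ)   = ↭-trans (concatMap⁺ σ) (concatMap⁺ ρ)

    triangle-edges : concatMap triEdges triangles ↭ map diff rest ++ map (N +_) (concatMap both rest)
    triangle-edges = ↭-trans (↭-reflexive (concatMap-map triEdges triangle rest)) (concatMap-extract N row rest)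
      where
      row : ∀ p → triEdges (triangle p) ↭ diff p ∷ map (N +_) (both p)
      row p = ↭-trans (↭-reflexive (cong₂ (λ a b → N + left p ∷ a ∷ b ∷ [])
        (trans (cong (λ z → ∣ N + left p - z ∣) (sym (+-assoc N (left p) (diff p)))) (dist-+ʳ (N + left p) (diff p)))
        (dist-zeroʳ (N + right p)))) (swap _ _ ↭-refl)

    shuffle : ∀ L u b → L + (u + b) ≡ b + (L + u)
    shuffle = solve-∀

    pentagon-edges : concatMap pentEdges (map pentagon quads) ↭ map gapOf quads ++ map (L +_) (concatMap topEdges quads)
    pentagon-edges = ↭-trans (↭-reflexive (concatMap-map pentEdges pentagon quads)) (concatMap-extract L row quads)
      where
      cancel : ∀ n x z → ∣ n + x - n + z ∣ ≡ ∣ x - z ∣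
      cancel zero    x z = refl
      cancel (suc n) x z = cancel n x z
      row : ∀ p → pentEdges (pentagon p) ↭ gapOf p ∷ map (L +_) (topEdges p)
      row p = begin
        pentEdges (pentagon p)
          ≡⟨ cong₂ (λ x z → L + (u p + b p) ∷ x ∷ z)
               (trans (cong (λ z → ∣ z - b p ∣) (shuffle L (u p) (b p))) (dist-+ˡ (b p) (L + u p)))
               (cong₂ _∷_ (trans (cong (λ z → ∣ b p - z ∣) (shuffle L (w p) (b p))) (dist-+ʳ (b p) (L + w p)))
                 (cong₂ (λ x z → x ∷ z ∷ []) (cancel L (w p + b p) (d p)) (dist-zeroʳ (L + d p)))) ⟩
        L + (u p + b p) ∷ L + u p ∷ L + w p ∷ gapOf p ∷ L + d p ∷ []
          ↭⟨ shift (gapOf p) (L + (u p + b p) ∷ L + u p ∷ L + w p ∷ []) (L + d p ∷ []) ⟩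
        gapOf p ∷ map (L +_) (topEdges p) ∎
        where open PermutationReasoning

    T≡ : L + τ ≡ v + (N + R)
    T≡ = begin
      N + suc (2 * suc t) + τ     ≡⟨ +-assoc N (suc (2 * suc t)) τ ⟩
      N + (suc (2 * suc t) + τ)   ≡⟨ cong (N +_) midpoint ⟨
      N + (y + 2 * v)             ≡⟨ e N y v ⟩
      v + (N + (y + v))           ∎
      where
      open ≡-Reasoning
      e : ∀ N y v → N + (y + 2 * v) ≡ v + (N + (y + v))
      e = solve-∀

    -- Since T = Y + 2v and N + R = Y + v, the two edges at v have labels T - v = N + R and N + R -
    -- v = Y. The edge from N + R to N + R̄ keeps the difference of the removed pair.
    special-edges : pentEdges special ≡ L + τ ∷ N + R ∷ N + y ∷ diff p₀ ∷ N + R̄ ∷ []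
    special-edges = cong₂ (λ x z → L + τ ∷ x ∷ z)
      (trans (cong (λ z → ∣ z - v ∣) T≡) (dist-+ˡ v (N + R)))
      (cong₂ _∷_ (trans (cong (λ z → ∣ v - z ∣) (e N y v)) (dist-+ʳ v (N + y)))
        (cong₂ (λ x z → x ∷ z ∷ []) dist-R̄ (dist-zeroʳ (N + R̄))))
      where
      e : ∀ N y v → N + (y + v) ≡ v + (N + y)
      e = solve-∀

  edges-↭ : edgeLabels triangles pentagons ↭ interval 1 L ++ map (L +_) tops
  edges-↭ = begin
    concatMap triEdges triangles ++ pentEdges special ++ concatMap pentEdges (map pentagon quads)
      ↭⟨ ++⁺ triangle-edges (++⁺ (↭-reflexive special-edges) pentagon-edges) ⟩
    (δs ++ xs) ++ (L + τ ∷ N + R ∷ N + y ∷ diff p₀ ∷ N + R̄ ∷ []) ++ (ss ++ es)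
      -- The labels are sorted into four groups that fill 1, ..., q, then q+1, ..., N, then N+1,
      -- ..., L, and finally the tops. The special pentagon returns the removed pair to the second
      -- and third groups and fills the hole y.
      ↭⟨ ↭-Solver.solve 9 (λ δs xs T r y δ r̄ ss es → (δs ⊕′ xs) ⊕′ ((T ⊕′ (r ⊕′ (y ⊕′ (δ ⊕′ r̄)))) ⊕′ (ss ⊕′ es)) ⊜ (ss ⊕′ ((δ ⊕′ δs) ⊕′ ((y ⊕′ (r ⊕′ (r̄ ⊕′ xs))) ⊕′ (T ⊕′ es))))) ↭-refl
           δs xs (L + τ ∷ []) (N + R ∷ []) (N + y ∷ []) (diff p₀ ∷ []) (N + R̄ ∷ []) ss es ⟩
    ss ++ (diff p₀ ∷ δs) ++ map (N +_) (y ∷ R ∷ R̄ ∷ concatMap both rest) ++ map (L +_) (τ ∷ concatMap topEdges quads)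
      ↭⟨ ++⁺ gaps (++⁺ (↭-trans (map⁺ diff (↭-sym pairs-↭)) differences) (++⁺ (map⁺ (N +_) all-positions) (map⁺ (L +_) edge-tops))) ⟩
    interval 1 q ++ interval (suc q) (suc t) ++ map (N +_) (interval 1 (suc (2 * suc t))) ++ map (L +_) tops
      ≡⟨ ++-assoc (interval 1 q) (interval (suc q) (suc t)) _ ⟨
    (interval 1 q ++ interval (suc q) (suc t)) ++ map (N +_) (interval 1 (suc (2 * suc t))) ++ map (L +_) tops
      ≡⟨ cong₂ (λ a b → a ++ b ++ map (L +_) tops) (interval-++ 1 q (suc t)) (trans (map-+-interval N 1 (suc (2 * suc t))) (cong (λ z → interval z (suc (2 * suc t))) (+-comm N 1))) ⟩
    interval 1 N ++ interval (1 + N) (suc (2 * suc t)) ++ map (L +_) tops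
      ≡⟨ ++-assoc (interval 1 N) _ _ ⟨
    (interval 1 N ++ interval (1 + N) (suc (2 * suc t))) ++ map (L +_) tops
      ≡⟨ cong (_++ map (L +_) tops) (interval-++ 1 N (suc (2 * suc t))) ⟩
    interval 1 L ++ map (L +_) tops ∎
    where
    open PermutationReasoning
    open ↭-Solver using (_⊜_) renaming (_⊕_ to _⊕′_)
    δs = map diff rest
    xs = map (N +_) (concatMap both rest)
    ss = map gapOf quads
    es = map (L +_) (concatMap topEdges quads)

  private
    -- The nonzero vertex labels lie in the disjoint ranges (0, N], (N, L] and (L, L+M], so
    -- distinctness need only be checked inside each.
    small middle large : List ℕ
    small  = v ∷ map b quads
    middle = map (N +_) (R ∷ R̄ ∷ concatMap both rest)
    large  = map (L +_) (τ ∷ concatMap topVertices quads)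

    vertices-↭ : vertexLabels triangles pentagons ↭ 0 ∷ small ++ middle ++ large
    vertices-↭ = prep 0 (begin
      concatMap triVertices triangles ++ pentVertices special ++ concatMap pentVertices (map pentagon quads)
        ↭⟨ ++⁺ (↭-reflexive (trans (concatMap-map triVertices triangle rest) (sym (map-concatMap (N +_) both rest))))
             (++⁺ˡ (pentVertices special) (↭-trans (↭-reflexive (concatMap-map pentVertices pentagon quads)) (concatMap-extract L (λ p → swap _ _ ↭-refl) quads))) ⟩
      xs ++ (L + τ ∷ v ∷ N + R ∷ N + R̄ ∷ []) ++ bs ++ cs
        ↭⟨ ↭-Solver.solve 7 (λ xs T v r r̄ bs cs → xs ⊕′ ((T ⊕′ (v ⊕′ (r ⊕′ r̄))) ⊕′ (bs ⊕′ cs)) ⊜ ((v ⊕′ bs) ⊕′ ((r ⊕′ (r̄ ⊕′ xs)) ⊕′ (T ⊕′ cs)))) ↭-refl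
             xs (L + τ ∷ []) (v ∷ []) (N + R ∷ []) (N + R̄ ∷ []) bs cs ⟩
      small ++ middle ++ large ∎)
      where
      open PermutationReasoning
      open ↭-Solver using (_⊜_) renaming (_⊕_ to _⊕′_)
      xs = map (N +_) (concatMap both rest)
      bs = map b quads
      cs = map (L +_) (concatMap topVertices quads)

    bs-unique : Unique (map b quads)
    bs-unique = unique-suffix unused′ (Unique-resp-↭ (↭-sym inner) (interval-unique _ _))

    bs->0 : All (0 <_) (map b quads)
    bs->0 = All.++⁻ʳ unused′ (All-resp-↭ (↭-sym inner) (All.map (≤-trans (s≤s z≤n)) (interval-≥ (suc base) size)))

    bs-<v : All (_< v) (map b quads)
    bs-<v = All.++⁻ʳ unused′ (All-resp-↭ (↭-sym inner) (All.map (λ b< → <-≤-trans b< b+s<v) (interval-< (suc base) size)))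
      where
      b+s<v : base + size < v
      -- Twice the bound on the inner labels is less than 3q+6+τ, which is at most 2v.
      b+s<v = *-cancelˡ-< 2 (base + size) v (<-≤-trans inner-< v-≥)

    small-unique : Unique small
    small-unique = All.map >⇒≢ bs-<v ∷ bs-unique

    small-≤ : All (_≤ N) small
    small-≤ = v-≤ ∷ All.map (λ b<v → ≤-trans (<⇒≤ b<v) v-≤) bs-<v

    small->0 : All (0 <_) small
    small->0 = 0<v ∷ bs->0

    tail-of : {P : ℕ → Set} → All P (interval 1 (suc (2 * suc t))) → All P (R ∷ R̄ ∷ concatMap both rest)
    tail-of = All.++⁻ʳ (y ∷ []) ∘ All-resp-↭ (↭-sym all-positions)

    middle-unique : Unique middle
    middle-unique = Unique.map⁺ (+-cancelˡ-≡ N _ _) (unique-suffix (y ∷ []) (Unique-resp-↭ (↭-sym all-positions) (interval-unique 1 _)))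

    middle-> : All (N <_) middle
    middle-> = All.map⁺ (All.map (λ {x} 0<x → ≤-trans (≤-reflexive (+-comm 1 N)) (+-monoʳ-≤ N 0<x)) (tail-of (interval-≥ 1 _)))

    middle-≤ : All (_≤ L) middle
    middle-≤ = All.map⁺ (All.map (λ x< → +-monoʳ-≤ N (s≤s⁻¹ x<)) (tail-of (interval-< 1 _)))

    tops-of : {P : ℕ → Set} → All P (interval 1 M) → All P (τ ∷ concatMap topVertices quads)
    tops-of = All.++⁻ʳ unused ∘ All-resp-↭ (↭-sym vertex-tops)

    large-unique : Unique large
    large-unique = Unique.map⁺ (+-cancelˡ-≡ L _ _) (unique-suffix unused (Unique-resp-↭ (↭-sym vertex-tops) (interval-unique 1 _)))

    large-> : All (L <_) large
    large-> = All.map⁺ (All.map (λ {x} 0<x → ≤-trans (≤-reflexive (+-comm 1 L)) (+-monoʳ-≤ L 0<x)) (tops-of (interval-≥ 1 _)))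

    large-≤ : All (_≤ L + M) large
    large-≤ = All.map⁺ (All.map (λ x< → +-monoʳ-≤ L (s≤s⁻¹ x<)) (tops-of (interval-< 1 _)))

    N≤L : N ≤ L
    N≤L = m≤m+n N _

  vertices-unique : Unique (vertexLabels triangles pentagons)
  vertices-unique = Unique-resp-↭ (↭-sym vertices-↭)
    (unique-++-< ([] ∷ []) (unique-++-< small-unique (unique-++-< middle-unique large-unique middle-≤ large->) small-≤
      (All.++⁺ middle-> (All.map (≤-<-trans N≤L) large->)))
      (z≤n ∷ []) (All.++⁺ small->0 (All.++⁺ (All.map (≤-<-trans z≤n) middle->) (All.map (≤-<-trans z≤n) large->))))

  vertices-≤ : All (_≤ L + M) (vertexLabels triangles pentagons)
  vertices-≤ = All-resp-↭ (↭-sym vertices-↭)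
    (z≤n ∷ All.++⁺ (All.map (λ x≤ → ≤-trans x≤ (≤-trans N≤L (m≤m+n L M))) small-≤)
      (All.++⁺ (All.map (λ x≤ → ≤-trans x≤ (m≤m+n L M)) middle-≤) large-≤))

-- Choice of the Langford system and of the midpoint

record Configuration (q τ t : ℕ) : Set where
  field
    {y v}    : ℕ
    langford : Langford q (suc t) y
    midpoint : y + 2 * v ≡ suc (2 * suc t) + τ
    v-≥      : 3 * q + 6 + τ ≤ 2 * v
    v-≤      : v ≤ q + suc t

-- With p = q+1 there are 3t+5p = L+4q+1 edges, so the tops are exactly what is missing after 1,
-- ..., L.
graceful : ∀ {q τ t K} → Configuration q τ t → Ordinary q τ K (interval 1 K) → K ≡ suc (4 * q) → Graceful t (suc q)
graceful {q} {τ} {t} {K} Γ Ω eq = subst₂ Graceful length-triangles length-pentagons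
  (label , subst (λ m → IsGraceful (C3C5 (length triangles) (length pentagons)) m label) (sym m≡)
    (label-injective vertices-unique , label-bounded vertices-≤ ,
     edgeLabel-bijOnto _ (↭-trans edges-↭ (↭-reflexive (interval-shift L K))) (interval-unique 1 (L + K))
       (λ k∈ → All.lookup (interval-≥ 1 (L + K)) k∈ , s≤s⁻¹ (All.lookup (interval-< 1 (L + K)) k∈))
       (λ { (1≤k , k≤m) → ∈-interval 1 (L + K) 1≤k (s≤s k≤m) })))
  where
  open Configuration Γ
  open Assembly langford Ω midpoint v-≥ v-≤
  open Labelling triangles pentagons
  count : ∀ q t → 3 * t + 5 * suc q ≡ q + suc t + suc (2 * suc t) + suc (4 * q)
  count = solve-∀
  m≡ : edges (length triangles) (length pentagons) ≡ L + K
  m≡ = trans (cong₂ edges length-triangles length-pentagons) (trans (count q t) (cong (L +_) (sym eq)))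

-- Now m = L+K+1. The hooked tops skip m and use m+1, the second of the two allowed sets of edge
-- labels.
nearGraceful : ∀ {q τ t K} → Configuration q τ t → Ordinary q τ (2 + K) (hooked K) → K ≡ 4 * q → NearGraceful t (suc q)
nearGraceful {q} {τ} {t} {K} Γ Ω eq = subst₂ NearGraceful length-triangles length-pentagons
  (label , subst (λ m → IsNearGraceful (C3C5 (length triangles) (length pentagons)) m label) (sym m≡)
    (label-injective vertices-unique , (λ x → ≤-trans (label-bounded vertices-≤ x) (≤-reflexive (two L K))) ,
     inj₂ (edgeLabel-bijOnto _ (↭-trans edges-↭ (↭-reflexive (hooked-shift L K))) (hooked-unique (L + K)) (hooked-sound (L + K)) (hooked-complete (L + K)))))
  where
  open Configuration Γ
  open Assembly langford Ω midpoint v-≥ v-≤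
  open Labelling triangles pentagons
  count : ∀ q t → 3 * t + 5 * suc q ≡ suc (q + suc t + suc (2 * suc t) + 4 * q)
  count = solve-∀
  m≡ : edges (length triangles) (length pentagons) ≡ suc (L + K)
  m≡ = trans (cong₂ edges length-triangles length-pentagons) (trans (count q t) (cong (λ z → suc (L + z)) (sym eq)))
  two : ∀ L K → L + (2 + K) ≡ suc (suc (L + K))
  two = solve-∀

-- Taking a = 2+2g in `langford-even` gives t+1 pairs and T - Y = 3q+τ+6+6g, so the parity condition
-- is on 3q+τ.
configuration-even : ∀ q τ g w → 3 * q + τ ≡ 2 * w → τ ≤ 2 * q + 2 → Configuration q τ (2 * q + 3 + 4 * g)
configuration-even q τ g w eq τ≤ = record
  { v = w + 3 * g + 3
  ; langford = subst (λ n → Langford q n (1 + (q + (2 + 2 * g)))) (e₁ q g) (langford-even q (2 + 2 * g))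
  ; midpoint = trans (e₂ q g w) (trans (cong (λ z → 9 + q + 8 * g + z) (sym eq)) (e₃ q τ g))
  -- For g = 0, that is t = 2p+1, this is an equality: the bound 3q+6+τ is the value of 2v there.
  ; v-≥ = ≤-by (6 * g) 2v
  ; v-≤ = *-cancelˡ-≤ 2 (≤-trans (≤-reflexive (sym 2v)) (≤-trans (+-monoˡ-≤ (6 * g) (+-monoʳ-≤ (3 * q + 6) τ≤)) (≤-by (q + 2 * g) (e₄ q g))))
  }
  where
  e₁ : ∀ q g → 2 * (q + (2 + 2 * g)) ≡ suc (2 * q + 3 + 4 * g)
  e₁ = solve-∀
  e₂ : ∀ q g w → 1 + (q + (2 + 2 * g)) + 2 * (w + 3 * g + 3) ≡ 9 + q + 8 * g + 2 * w
  e₂ = solve-∀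
  e₃ : ∀ q τ g → 9 + q + 8 * g + (3 * q + τ) ≡ suc (2 * suc (2 * q + 3 + 4 * g)) + τ
  e₃ = solve-∀
  e₄ : ∀ q g → 3 * q + 6 + (2 * q + 2) + 6 * g + (q + 2 * g) ≡ 2 * (q + suc (2 * q + 3 + 4 * g))
  e₄ = solve-∀
  2v : 3 * q + 6 + τ + 6 * g ≡ 2 * (w + 3 * g + 3)
  2v = trans (l q τ g) (trans (cong (λ z → z + (6 + 6 * g)) eq) (r w g))
    where
    l : ∀ q τ g → 3 * q + 6 + τ + 6 * g ≡ 3 * q + τ + (6 + 6 * g)
    l = solve-∀
    r : ∀ w g → 2 * w + (6 + 6 * g) ≡ 2 * (w + 3 * g + 3)
    r = solve-∀

-- `langford-odd` has its hole at 1+a, so T - Y = 4q+3a+τ+2, and the parity condition is on 3a+τ.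
-- Both bounds on v come from a ≥ 2.
configuration-odd : ∀ q τ a w → 3 * a + τ ≡ 2 * w → 2 ≤ a → τ ≤ 2 * q + 2 → Configuration q τ (2 * q + 2 * a)
configuration-odd q τ a w eq 2≤a τ≤ = record
  { v = w + 2 * q + 1
  ; langford = subst (λ n → Langford q n (1 + a)) (e₁ q a) (langford-odd q a)
  ; midpoint = trans (e₂ q a w) (trans (cong (λ z → 3 + a + 4 * q + z) (sym eq)) (e₃ q τ a))
  ; v-≥ = ≤-trans (+-monoˡ-≤ τ (+-mono-≤ (*-monoˡ-≤ q (≤-by {3} {4} 1 refl)) (*-monoʳ-≤ 3 2≤a)))
            (≤-by 2 2v)
  ; v-≤ = *-cancelˡ-≤ 2 (≤-trans (≤-reflexive (sym 2v)) (≤-trans (+-monoˡ-≤ 2 (+-monoʳ-≤ (4 * q + 3 * a) τ≤))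
            (≤-trans (+-monoʳ-≤ (4 * q + 3 * a + (2 * q + 2)) 2≤a) (≤-reflexive (e₄ q a)))))
  }
  where
  e₁ : ∀ q a → 1 + 2 * (q + a) ≡ suc (2 * q + 2 * a)
  e₁ = solve-∀
  e₂ : ∀ q a w → 1 + a + 2 * (w + 2 * q + 1) ≡ 3 + a + 4 * q + 2 * w
  e₂ = solve-∀
  e₃ : ∀ q τ a → 3 + a + 4 * q + (3 * a + τ) ≡ suc (2 * suc (2 * q + 2 * a)) + τ
  e₃ = solve-∀
  e₄ : ∀ q a → 4 * q + 3 * a + (2 * q + 2) + a ≡ 2 * (q + suc (2 * q + 2 * a))
  e₄ = solve-∀
  2v : 4 * q + 3 * a + τ + 2 ≡ 2 * (w + 2 * q + 1)
  2v = trans (l q τ a) (trans (cong (λ z → z + (4 * q + 2)) eq) (r w q))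
    where
    l : ∀ q τ a → 4 * q + 3 * a + τ + 2 ≡ 3 * a + τ + (4 * q + 2)
    l = solve-∀
    r : ∀ w q → 2 * w + (4 * q + 2) ≡ 2 * (w + 2 * q + 1)
    r = solve-∀

-- Residues modulo 4

%4-cong : ∀ {t} s k → t ≡ s + k * 4 → t % 4 ≡ s % 4
%4-cong s k refl = [m+kn]%n≡m%n s k 4

≤⇒∃ : ∀ {m n} → m ≤ n → ∃ λ e → n ≡ m + e
≤⇒∃ {m} m≤n = _ , sym (m+[n∸m]≡n m≤n)

impossible : ∀ {x r s c : ℕ} {A : Set} → x ≡ c → x ≡ r ⊎ x ≡ s → (c ≡ r → A) → (c ≡ s → A) → A
impossible refl (inj₁ eq) f g = f eq
impossible refl (inj₂ eq) f g = g eq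

-- Let e = t - (2p+1). Here 2p+1 is 3 modulo 4, so the allowed residues of t are e = 0 and e = 1
-- modulo 4. In the second case a = 2+2g is even like τ.
configuration-q-even : ∀ h w t → 2 * w ≤ 2 * (2 * h) + 2 → 2 * suc (2 * h) + 1 ≤ t → t % 4 ≡ 0 ⊎ t % 4 ≡ 3 → Configuration (2 * h) (2 * w) t
configuration-q-even h w t τ≤ t≥ t% with ≤⇒∃ t≥
... | e , refl with e divMod 4
... | result g zero refl = subst (Configuration (2 * h) (2 * w)) (e₁ h g) (configuration-even (2 * h) (2 * w) g (3 * h + w) (e₂ h w) τ≤)
  where
  e₁ : ∀ h g → 2 * (2 * h) + 3 + 4 * g ≡ 2 * suc (2 * h) + 1 + g * 4
  e₁ = solve-∀
  e₂ : ∀ h w → 3 * (2 * h) + 2 * w ≡ 2 * (3 * h + w)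
  e₂ = solve-∀
... | result g (suc zero) refl = subst (Configuration (2 * h) (2 * w)) (e₁ h g) (configuration-odd (2 * h) (2 * w) (2 + 2 * g) (3 + 3 * g + w) (e₂ g w) (≤-by _ refl) τ≤)
  where
  e₁ : ∀ h g → 2 * (2 * h) + 2 * (2 + 2 * g) ≡ 2 * suc (2 * h) + 1 + (1 + g * 4)
  e₁ = solve-∀
  e₂ : ∀ g w → 3 * (2 + 2 * g) + 2 * w ≡ 2 * (3 + 3 * g + w)
  e₂ = solve-∀
... | result g (suc (suc zero)) refl = impossible (%4-cong 1 (1 + h + g) (e₁ h g)) t% (λ ()) (λ ())
  where
  e₁ : ∀ h g → 2 * suc (2 * h) + 1 + (2 + g * 4) ≡ 1 + (1 + h + g) * 4
  e₁ = solve-∀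
... | result g (suc (suc (suc zero))) refl = impossible (%4-cong 2 (1 + h + g) (e₁ h g)) t% (λ ()) (λ ())
  where
  e₁ : ∀ h g → 2 * suc (2 * h) + 1 + (3 + g * 4) ≡ 2 + (1 + h + g) * 4
  e₁ = solve-∀

-- Now 2p+1 is 1 modulo 4, so the allowed residues are e = 0 and e = 3 modulo 4. In the second case
-- a = 3+2g is odd like τ.
configuration-q-odd : ∀ h w t → 1 + 2 * w ≤ 2 * (1 + 2 * h) + 2 → 2 * (2 + 2 * h) + 1 ≤ t → t % 4 ≡ 0 ⊎ t % 4 ≡ 1 → Configuration (1 + 2 * h) (1 + 2 * w) t
configuration-q-odd h w t τ≤ t≥ t% with ≤⇒∃ t≥
... | e , refl with e divMod 4
... | result g zero refl = subst (Configuration (1 + 2 * h) (1 + 2 * w)) (e₁ h g) (configuration-even (1 + 2 * h) (1 + 2 * w) g (2 + 3 * h + w) (e₂ h w) τ≤)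
  where
  e₁ : ∀ h g → 2 * (1 + 2 * h) + 3 + 4 * g ≡ 2 * (2 + 2 * h) + 1 + g * 4
  e₁ = solve-∀
  e₂ : ∀ h w → 3 * (1 + 2 * h) + (1 + 2 * w) ≡ 2 * (2 + 3 * h + w)
  e₂ = solve-∀
... | result g (suc zero) refl = impossible (%4-cong 2 (1 + h + g) (e₁ h g)) t% (λ ()) (λ ())
  where
  e₁ : ∀ h g → 2 * (2 + 2 * h) + 1 + (1 + g * 4) ≡ 2 + (1 + h + g) * 4
  e₁ = solve-∀
... | result g (suc (suc zero)) refl = impossible (%4-cong 3 (1 + h + g) (e₁ h g)) t% (λ ()) (λ ())
  where
  e₁ : ∀ h g → 2 * (2 + 2 * h) + 1 + (2 + g * 4) ≡ 3 + (1 + h + g) * 4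
  e₁ = solve-∀
... | result g (suc (suc (suc zero))) refl = subst (Configuration (1 + 2 * h) (1 + 2 * w)) (e₁ h g) (configuration-odd (1 + 2 * h) (1 + 2 * w) (3 + 2 * g) (5 + 3 * g + w) (e₂ g w) (≤-by (1 + 2 * g) refl) τ≤)
  where
  e₁ : ∀ h g → 2 * (1 + 2 * h) + 2 * (3 + 2 * g) ≡ 2 * (2 + 2 * h) + 1 + (3 + g * 4)
  e₁ = solve-∀
  e₂ : ∀ g w → 3 * (3 + 2 * g) + (1 + 2 * w) ≡ 2 * (5 + 3 * g + w)
  e₂ = solve-∀

residue : ∀ {r} p → p % 4 ≡ r → ∃ λ k → p ≡ r + 4 * k
residue p refl = p / 4 , trans (m≡m%n+[m/n]*n p 4) (cong (p % 4 +_) (*-comm (p / 4) 4))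

-- The four residue classes of p

graceful₀ : ∀ k t → 2 * (4 + 4 * k) + 1 ≤ t → t % 4 ≡ 0 ⊎ t % 4 ≡ 1 → Graceful t (4 + 4 * k)
graceful₀ k t t≥ t% = graceful (subst₂ (λ q τ → Configuration q τ t) (e₁ k) (e₂ k)
  (configuration-q-odd (1 + 2 * k) (2 + 3 * k) t (subst₂ (λ q τ → τ ≤ 2 * q + 2) (sym (e₁ k)) (sym (e₂ k)) (Ordinary.τ-≤ (ordinary₃ k)))
    (subst (λ q → 2 * suc q + 1 ≤ t) (sym (e₁ k)) t≥) t%)) (ordinary₃ k) (e₃ k)
  where
  e₁ : ∀ k → 1 + 2 * (1 + 2 * k) ≡ 3 + 4 * k
  e₁ = solve-∀
  e₂ : ∀ k → 1 + 2 * (2 + 3 * k) ≡ 5 + 6 * k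
  e₂ = solve-∀
  e₃ : ∀ k → 13 + 16 * k ≡ suc (4 * (3 + 4 * k))
  e₃ = solve-∀

graceful₃ : ∀ k t → 2 * (3 + 4 * k) + 1 ≤ t → t % 4 ≡ 0 ⊎ t % 4 ≡ 3 → Graceful t (3 + 4 * k)
graceful₃ k t t≥ t% = graceful (subst₂ (λ q τ → Configuration q τ t) (e₁ k) (e₂ k)
  (configuration-q-even (1 + 2 * k) (1 + k) t (subst₂ (λ q τ → τ ≤ 2 * q + 2) (sym (e₁ k)) (sym (e₂ k)) (Ordinary.τ-≤ (ordinary₂ k)))
    (subst (λ q → 2 * suc q + 1 ≤ t) (sym (e₁ k)) t≥) t%)) (ordinary₂ k) (e₃ k)
  where
  e₁ : ∀ k → 2 * (1 + 2 * k) ≡ 2 + 4 * k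
  e₁ = solve-∀
  e₂ : ∀ k → 2 * (1 + k) ≡ 2 + 2 * k
  e₂ = solve-∀
  e₃ : ∀ k → 9 + 16 * k ≡ suc (4 * (2 + 4 * k))
  e₃ = solve-∀

-- The case p = 1 has only the special pentagon. From p = 5 on the tables apply, with their
-- parameter one less than here.
nearGraceful₁ : ∀ k t → 2 * (1 + 4 * k) + 1 ≤ t → t % 4 ≡ 0 ⊎ t % 4 ≡ 3 → NearGraceful t (1 + 4 * k)
nearGraceful₁ zero    t t≥ t% = nearGraceful (configuration-q-even 0 1 t (≤-by 0 refl) t≥ t%) ordinary-none refl
nearGraceful₁ (suc k) t t≥ t% = subst (NearGraceful t) (e₄ k) (nearGraceful (subst₂ (λ q τ → Configuration q τ t) (e₁ k) (e₂ k)
  (configuration-q-even (2 + 2 * k) (3 + 3 * k) t (subst₂ (λ q τ → τ ≤ 2 * q + 2) (sym (e₁ k)) (sym (e₂ k)) (Ordinary.τ-≤ (ordinary₀ k)))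
    (subst (λ p → 2 * p + 1 ≤ t) (trans (sym (e₄ k)) (cong suc (sym (e₁ k)))) t≥) t%)) (ordinary₀ k) (e₃ k))
  where
  e₁ : ∀ k → 2 * (2 + 2 * k) ≡ 4 + 4 * k
  e₁ = solve-∀
  e₂ : ∀ k → 2 * (3 + 3 * k) ≡ 6 + 6 * k
  e₂ = solve-∀
  e₃ : ∀ k → 16 + 16 * k ≡ 4 * (4 + 4 * k)
  e₃ = solve-∀
  e₄ : ∀ k → 5 + 4 * k ≡ 1 + 4 * suc k
  e₄ = solve-∀

nearGraceful₂ : ∀ k t → 2 * (2 + 4 * k) + 1 ≤ t → t % 4 ≡ 0 ⊎ t % 4 ≡ 1 → NearGraceful t (2 + 4 * k)
nearGraceful₂ k t t≥ t% = nearGraceful (subst₂ (λ q τ → Configuration q τ t) (e₁ k) (e₂ k)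
  (configuration-q-odd (2 * k) (3 * k) t (subst₂ (λ q τ → τ ≤ 2 * q + 2) (sym (e₁ k)) (sym (e₂ k)) (Ordinary.τ-≤ (ordinary₁ k)))
    (subst (λ q → 2 * suc q + 1 ≤ t) (sym (e₁ k)) t≥) t%)) (ordinary₁ k) (e₃ k)
  where
  e₁ : ∀ k → 1 + 2 * (2 * k) ≡ 1 + 4 * k
  e₁ = solve-∀
  e₂ : ∀ k → 1 + 2 * (3 * k) ≡ 1 + 6 * k
  e₂ = solve-∀
  e₃ : ∀ k → 4 + 16 * k ≡ 4 * (1 + 4 * k)
  e₃ = solve-∀

theorem5p3 : (p t : ℕ) → 1 ≤ p → 2 * p + 1 ≤ t →
    ((p % 4 ≡ 0 → (t % 4 ≡ 0 ⊎ t % 4 ≡ 1) → Graceful t p)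
    × (p % 4 ≡ 3 → (t % 4 ≡ 0 ⊎ t % 4 ≡ 3) → Graceful t p)
    × (p % 4 ≡ 1 → (t % 4 ≡ 0 ⊎ t % 4 ≡ 3) → NearGraceful t p)
    × (p % 4 ≡ 2 → (t % 4 ≡ 0 ⊎ t % 4 ≡ 1) → NearGraceful t p))
theorem5p3 p t 1≤p t≥ = case₀ , case₃ , case₁ , case₂
  where
  case₀ : p % 4 ≡ 0 → t % 4 ≡ 0 ⊎ t % 4 ≡ 1 → Graceful t p
  case₀ p% t% with residue p p%
  -- Excluding p = 0 leaves p = 4+4k, hence q = 3+4k.
  ... | zero  , refl = contradiction 1≤p λ ()
  ... | suc k , eq with trans eq (*-suc 4 k)
  ...   | refl = graceful₀ k t t≥ t%
  case₃ : p % 4 ≡ 3 → t % 4 ≡ 0 ⊎ t % 4 ≡ 3 → Graceful t p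
  case₃ p% t% with residue p p%
  ... | k , refl = graceful₃ k t t≥ t%
  case₁ : p % 4 ≡ 1 → t % 4 ≡ 0 ⊎ t % 4 ≡ 3 → NearGraceful t p
  case₁ p% t% with residue p p%
  ... | k , refl = nearGraceful₁ k t t≥ t%
  case₂ : p % 4 ≡ 2 → t % 4 ≡ 0 ⊎ t % 4 ≡ 1 → NearGraceful t p
  case₂ p% t% with residue p p%
  ... | k , refl = nearGraceful₂ k t t≥ t%
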